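{- There are positive constants $c$ and $c'$ such that for all integers $n\ge 2$, \[ 2^{c\log^2 n}\;\le\; r\big(K_4^{(3)},\ S_n^{(3)}\big)\;\le\; 2^{c' n^{2/3}\log n}. \] Moreover, for each integer $s\ge 5$ there are positive constants $c_s$ and $c_s'$ such that for all integers $n\ge 2$, \[ 2^{c_s n}\;\le\; r\big(K_s^{(3)},\ S_n^{(3)}\big)\;\le\; 2^{c_s' n}. \]
   Context: A $3$-graph is a $3$-uniform hypergraph; $K_m^{(3)}$ denotes the complete $3$-graph on $m$ vertices. $S_n^{(3)}$ is the star $3$-graph on $n+1$ vertices: a distinguished vertex $v$ and $n$ further vertices, whose edges are all $\binom{n}{2}$ triples containing $v$. For $3$-graphs $H_1,H_2$, the Ramsey number $r(H_1,H_2)$ is the smallest $N$ such that every red/blue coloring of the edges of $K_N^{(3)}$ contains a red copy of $H_1$ or a blue copy of $H_2$. Logarithms are base $2$. -}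

module Defs where

open import Data.Nat using (ℕ; _<_)
open import Data.Fin using (Fin)
open import Data.Bool using (Bool; true; false)
open import Data.Product using (Σ; _×_; ∃)
open import Data.Sum using (_⊎_)
open import Relation.Binary.PropositionalEquality using (_≡_; _≢_)
open import Relation.Nullary using (¬_)
open import Function.Definitions using (Injective)

-- A red/blue colouring of the edges of K_N^(3) on vertex set Fin N,
-- represented as a function on ordered triples which is symmetric
-- (invariant under permutations of its arguments); true = red, false = blue.
-- Values on triples with repeated vertices are irrelevant.
Colouring : ℕ → Set
Colouring N = Fin N → Fin N → Fin N → Bool

Symmetric : ∀ {N} → Colouring N → Set
Symmetric {N} χ = (a b c : Fin N) → (χ a b c ≡ χ b a c) × (χ a b c ≡ χ a c b)

RedClique : ∀ {N} → Colouring N → ℕ → Set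
RedClique {N} χ s =
  Σ (Fin s → Fin N) λ f → Injective _≡_ _≡_ f ×
    ((i j k : Fin s) → i ≢ j → j ≢ k → i ≢ k → χ (f i) (f j) (f k) ≡ true)

BlueStar : ∀ {N} → Colouring N → ℕ → Set
BlueStar {N} χ n =
  Σ (Fin N) λ v → Σ (Fin n → Fin N) λ g → Injective _≡_ _≡_ g ×
    ((i : Fin n) → g i ≢ v) ×
    ((i j : Fin n) → i ≢ j → χ v (g i) (g j) ≡ false)

Arrows : ℕ → ℕ → ℕ → Set
Arrows N s n = (χ : Colouring N) → Symmetric χ → RedClique χ s ⊎ BlueStar χ n

IsRamseyNumber : ℕ → ℕ → ℕ → Set
IsRamseyNumber s n r = Arrows r s n × ((N : ℕ) → N < r → ¬ Arrows N s n)

module Submission where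

-- Upper bounds.  For every s, vertices are chosen one at a time while a pool of candidates is kept:
-- a red core v₁, …, vₖ forms red triples with the pool, and each vᵢ centres a blue star whose leaves
-- form blue triples with vᵢ and the pool.  A new vertex becomes a leaf at some vᵢ or enters the
-- core, at the cost of a factor s + 1 of the pool, so O(s n) rounds suffice.  For s = 4, put
-- σ ≈ √m ≥ n^(1/3): by Ramsey's theorem in the links, n ^ (σ² + O(σ)) vertices contain a₁, …, a_σ and
-- a large pool all of whose vertices form red triples with each pair aᵢ , aⱼ.  Without a red K₄ the
-- red links of the aᵢ are pairwise disjoint on the pool, so one has density at most 1/σ, and by the
-- Erdős–Szemerédi theorem it has a homogeneous n-set once the pool exceeds n ^ O(n/σ).  A clique
-- in the link of aᵢ is independent in the link of aⱼ, so either way a blue star appears.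
--
-- Lower bounds.  A triple is red when one of its vertices, the apex, stands in a suitable relation to
-- a random label of the opposite pair; then every link is random enough to contain no large blue
-- clique.  For s = 5 two colours with the rule z(ab) ≠ z(bc) for a < b < c work.  For s = 4 a label
-- is a colour in ℤ/3 and a letter.  Colour α on the two edges at the apex and α + 1 on the base
-- force every red K₄ to consist of two pairs {a , a′} < {b , b′} with a , a′ acting as apexes of bb′
-- and vice versa, and the letters are chosen to make exactly this impossible.

open import Defs
open import Algebra.Properties.Semiring.Sum using (sum-cong-≗; ∑-comm; ∑-distrib-+)
open import Data.Bool using (Bool; true; false; not; _∧_; _∨_)
import Data.Bool.Properties as Boolₚ
open import Data.Empty using (⊥; ⊥-elim)
open import Data.Fin as Fin
  using (Fin; zero; suc; finToFun; funToFin; combine; remQuot; quotient; remainder)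
import Data.Fin.Properties as Finₚ
open import Data.List as List using (List; []; _∷_; length)
open import Data.List.Membership.Propositional.Properties using (∈-lookup)
open import Data.List.Relation.Unary.All as All using (All; []; _∷_)
open import Data.List.Relation.Unary.AllPairs using (AllPairs; []; _∷_)
open import Data.Nat
open import Data.Nat.DivMod using (_/_; _%_; m≡m%n+[m/n]*n; m%n<n)
open import Data.Nat.Induction using (<-wellFounded; Acc; acc)
open import Data.Nat.Logarithm using (⌊log₂_⌋; ⌈log₂_⌉)
open import Data.Nat.Logarithm.Core using (⌊log2⌋; ⌈log2⌉)
open import Data.Nat.Properties
open import Data.Nat.Tactic.RingSolver using (solve-∀)
open import Data.Product using (Σ; _×_; _,_; proj₁; proj₂; ∃; ∃₂)
open import Data.Sum using (_⊎_; inj₁; inj₂; map₂; [_,_]′)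
open import Data.Vec.Functional using (foldr) renaming (_∷_ to _◂_)
open import Function using (_∘_; id)
open import Function.Definitions using (Injective)
open import Relation.Binary.Definitions using (tri<; tri≈; tri>)
open import Relation.Binary.PropositionalEquality
open import Relation.Nullary using (¬_; Dec; yes; no)
open import Relation.Nullary.Decidable
  using (⌊_⌋; map′; decidable-stable; from-yes; ¬?; _→-dec_; _×-dec_; _⊎-dec_)

open import Algebra.Properties.Semiring.Sum +-*-semiring
  using (sum; *-distribˡ-sum; *-distribʳ-sum)

Inj : ∀ {a b} → (Fin a → Fin b) → Set
Inj f = Injective _≡_ _≡_ f

-- Counting in finite sets

⌊⌋-true : ∀ {A : Set} (d : Dec A) → A → ⌊ d ⌋ ≡ true
⌊⌋-true (yes _) _ = refl
⌊⌋-true (no n) a = ⊥-elim (n a)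

true-⌊⌋ : ∀ {A : Set} (d : Dec A) → ⌊ d ⌋ ≡ true → A
true-⌊⌋ (yes a) _ = a

false-⌊⌋ : ∀ {A : Set} (d : Dec A) → ⌊ d ⌋ ≡ false → ¬ A
false-⌊⌋ (no n) _ = n

↑ˡ≢↑ʳ : ∀ {m n} (i : Fin m) (j : Fin n) → i Fin.↑ˡ n ≢ m Fin.↑ʳ j
↑ˡ≢↑ʳ zero j ()
↑ˡ≢↑ʳ (suc i) j e = ↑ˡ≢↑ʳ i j (Finₚ.suc-injective e)

sum-mono : ∀ {n} {f g : Fin n → ℕ} → (∀ i → f i ≤ g i) → sum f ≤ sum g
sum-mono {zero} h = z≤n
sum-mono {suc n} h = +-mono-≤ (h zero) (sum-mono (h ∘ suc))

sum-const : ∀ n c → sum {n} (λ _ → c) ≡ n * c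
sum-const zero c = refl
sum-const (suc n) c = cong (c +_) (sum-const n c)

sum-≤ : ∀ {n c} {f : Fin n → ℕ} → (∀ i → f i ≤ c) → sum f ≤ n * c
sum-≤ {n} {c} h = ≤-trans (sum-mono h) (≤-reflexive (sum-const n c))

∃-below-average : ∀ {n X} (g : Fin n → ℕ) → sum g < n * X → ∃ λ i → g i < X
∃-below-average {suc n} {X} g lt with g zero <? X
... | yes p = zero , p
... | no p with ∃-below-average (g ∘ suc)
                 (+-cancelˡ-< X _ _ (≤-<-trans (+-monoˡ-≤ _ (≮⇒≥ p)) lt))
... | i , q = suc i , q

∃-above-average : ∀ {n X} (g : Fin n → ℕ) → n * X < sum g → ∃ λ i → X < g i
∃-above-average {suc n} {X} g lt with X <? g zero
... | yes p = zero , p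
... | no p with ∃-above-average (g ∘ suc)
                 (+-cancelˡ-< X _ _ (<-≤-trans lt (+-monoˡ-≤ _ (≮⇒≥ p))))
... | i , q = suc i , q

𝟙 : Bool → ℕ
𝟙 true = 1
𝟙 false = 0

count : ∀ {n} → (Fin n → Bool) → ℕ
count p = sum (λ i → 𝟙 (p i))

count-not : ∀ {n} (p : Fin n → Bool) → count p + count (not ∘ p) ≡ n
count-not {zero} p = refl
count-not {suc n} p with p zero
... | true = cong suc (count-not (p ∘ suc))
... | false = trans (+-suc _ _) (cong suc (count-not (p ∘ suc)))

Selection : ∀ {n} → (Fin n → Bool) → ℕ → Set
Selection {n} p k = Σ (Fin k → Fin n) λ ι → Inj ι × ∀ i → p (ι i) ≡ true

select : ∀ {n k} (p : Fin n → Bool) → k ≤ count p → Selection p k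
select {n} {zero} p _ = (λ ()) , (λ { {()} }) , λ ()
select {suc n} {suc k} p le with p zero in eq
... | false = let ι , inj , h = select {n} {suc k} (p ∘ suc) le in
  suc ∘ ι , (inj ∘ Finₚ.suc-injective) , h
... | true with select {n} {k} (p ∘ suc) (≤-pred le)
... | ι , inj , h = zero ◂ (suc ∘ ι) , inj′ , h′
  where
  inj′ : Inj (zero ◂ (suc ∘ ι))
  inj′ {zero} {zero} _ = refl
  inj′ {suc i} {suc j} e = cong suc (inj (Finₚ.suc-injective e))
  h′ : ∀ i → p ((zero ◂ (suc ∘ ι)) i) ≡ true
  h′ zero = eq
  h′ (suc i) = h i

first : ∀ b {m} → b ≡ true → Fin (𝟙 b + m)
first true _ = zero

first≢ : ∀ b {m} (e : b ≡ true) (x : Fin m) → first b e ≢ 𝟙 b Fin.↑ʳ x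
first≢ true _ _ ()

rank : ∀ {n} (p : Fin n → Bool) → (i : Fin n) → p i ≡ true → Fin (count p)
rank p zero e = first (p zero) e
rank p (suc i) e = 𝟙 (p zero) Fin.↑ʳ rank (p ∘ suc) i e

rank-injective : ∀ {n} (p : Fin n → Bool) {i j} (e : p i ≡ true) (e′ : p j ≡ true) →
                 rank p i e ≡ rank p j e′ → i ≡ j
rank-injective p {zero} {zero} e e′ h = refl
rank-injective p {zero} {suc j} e e′ h = ⊥-elim (first≢ (p zero) e _ h)
rank-injective p {suc i} {zero} e e′ h = ⊥-elim (first≢ (p zero) e′ _ (sym h))
rank-injective p {suc i} {suc j} e e′ h =
  cong suc (rank-injective (p ∘ suc) e e′ (Finₚ.↑ʳ-injective (𝟙 (p zero)) _ _ h))

-- Ranks of distinct selected elements are distinct, so a selection embeds into `Fin (count p)`.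
-- This is the converse of `select`.
selection⇒≤count : ∀ {n k} (p : Fin n → Bool) → Selection p k → k ≤ count p
selection⇒≤count p (ι , inj , h) =
  Finₚ.injective⇒≤ {f = λ i → rank p (ι i) (h i)} (λ {i} {j} e → inj (rank-injective p (h i) (h j) e))

-- The extra point of the codomain serves as a junk value when there is nothing to cover.
cover : ∀ {n c} (p : Fin n → Bool) → count p ≤ c →
        Σ (Fin c → Fin (suc n)) λ h → ∀ i → p i ≡ true → ∃ λ j → h j ≡ suc i
cover {zero} p _ = (λ _ → zero) , λ ()
cover {suc n} {c} p le with p zero in eq
cover {suc n} {c} p le | false with cover {n} {c} (p ∘ suc) le
... | h , ok = lift ∘ h , ok′
  where
  lift : Fin (suc n) → Fin (suc (suc n))
  lift zero = zero
  lift (suc i) = suc (suc i)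
  ok′ : ∀ i → p i ≡ true → ∃ λ j → lift (h j) ≡ suc i
  ok′ zero e with () ← trans (sym e) eq
  ok′ (suc i) e = proj₁ (ok i e) , cong lift (proj₂ (ok i e))
cover {suc n} {suc c} p le | true with cover {n} {c} (p ∘ suc) (≤-pred le)
... | h , ok = suc zero ◂ (lift ∘ h) , ok′
  where
  lift : Fin (suc n) → Fin (suc (suc n))
  lift zero = zero
  lift (suc i) = suc (suc i)
  ok′ : ∀ i → p i ≡ true → ∃ λ j → (suc zero ◂ (lift ∘ h)) j ≡ suc i
  ok′ zero e = zero , refl
  ok′ (suc i) e = suc (proj₁ (ok i e)) , cong lift (proj₂ (ok i e))

_≡ᵇᶠ_ : ∀ {n} → Fin n → Fin n → Bool
i ≡ᵇᶠ j = ⌊ i Fin.≟ j ⌋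

≡ᵇᶠ-sound : ∀ {n} {i j : Fin n} → (i ≡ᵇᶠ j) ≡ true → i ≡ j
≡ᵇᶠ-sound {i = i} {j} = true-⌊⌋ (i Fin.≟ j)

≡ᵇᶠ-refl : ∀ {n} (i : Fin n) → (i ≡ᵇᶠ i) ≡ true
≡ᵇᶠ-refl i = ⌊⌋-true (i Fin.≟ i) refl

≢⇒≡ᵇᶠ-false : ∀ {n} {i j : Fin n} → i ≢ j → (i ≡ᵇᶠ j) ≡ false
≢⇒≡ᵇᶠ-false {i = i} {j} ne with i Fin.≟ j
... | yes p = ⊥-elim (ne p)
... | no _ = refl

count-≡ : ∀ {n} (i : Fin n) → count (i ≡ᵇᶠ_) ≡ 1
count-≡ {suc n} zero = cong suc (trans (sum-const n 0) (*-zeroʳ n))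
count-≡ {suc n} (suc i) = trans (sum-cong-≗ +-*-semiring lemma) (count-≡ i)
  where
  lemma : ∀ j → 𝟙 (suc i ≡ᵇᶠ suc j) ≡ 𝟙 (i ≡ᵇᶠ j)
  lemma j with i Fin.≟ j
  ... | yes _ = refl
  ... | no _ = refl

fibre-sum : ∀ {M C} (f : Fin M → Fin C) → sum (λ c → count (λ i → f i ≡ᵇᶠ c)) ≡ M
fibre-sum {M} {C} f = begin
  sum (λ c → sum (λ i → 𝟙 (f i ≡ᵇᶠ c))) ≡⟨ ∑-comm +-*-semiring (λ c i → 𝟙 (f i ≡ᵇᶠ c)) ⟩
  sum (λ i → count (f i ≡ᵇᶠ_))          ≡⟨ sum-cong-≗ +-*-semiring (λ i → count-≡ (f i)) ⟩
  sum {M} (λ _ → 1)                     ≡⟨ sum-const M 1 ⟩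
  M * 1                                 ≡⟨ *-identityʳ M ⟩
  M                                     ∎
  where open ≡-Reasoning

Fibre : ∀ {M C} → (Fin M → Fin C) → ℕ → Set
Fibre {M} {C} f a = Σ (Fin C) λ c → Σ (Fin a → Fin M) λ ι → Inj ι × ∀ i → f (ι i) ≡ c

pigeonhole : ∀ {M C} a → 1 ≤ C → (f : Fin M → Fin C) → C * a ≤ M → Fibre f a
pigeonhole {M} {suc C} zero _ f _ = zero , (λ ()) , (λ { {()} }) , λ ()
pigeonhole {M} {suc C} (suc a) _ f le =
  let lt = subst (suc C * a <_) (sym (fibre-sum f))
             (<-≤-trans (*-monoʳ-< (suc C) (n<1+n a)) le)
      c , q = ∃-above-average (λ c → count (λ i → f i ≡ᵇᶠ c)) lt
      ι , inj , h = select (λ i → f i ≡ᵇᶠ c) q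
  in c , ι , inj , (λ i → ≡ᵇᶠ-sound (h i))

-- If fewer than `a` elements satisfy `p`, then at least `suc M ∸ a`, hence at least `b`, fail it.
-- The slack of one later pays for the vertex whose neighbourhoods are being split.
split : ∀ {M} a b (p : Fin M → Bool) → a + b ≤ suc M →
        Selection p a ⊎ Selection (not ∘ p) b
split {M} a b p le with a ≤? count p
... | yes q = inj₁ (select p q)
... | no q = inj₂ (select (not ∘ p) (+-cancelˡ-≤ (suc (count p)) _ _ (begin
    suc (count p) + b ≤⟨ +-monoˡ-≤ b (≰⇒> q) ⟩
    a + b ≤⟨ le ⟩
    suc M ≡⟨ cong suc (count-not p) ⟨
    suc (count p) + count (not ∘ p) ∎)))
  where open ≤-Reasoning

-- A finite, constructive choice: it turns "every vertex gives a clique or there is a star" into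
-- "all give cliques, or there is a star".
distribute : ∀ {n} {P : Fin n → Set} {Q : Set} → (∀ i → P i ⊎ Q) → (∀ i → P i) ⊎ Q
distribute {zero} h = inj₁ λ ()
distribute {suc n} {P} h with h zero | distribute (h ∘ suc)
... | inj₂ q | _ = inj₂ q
... | _ | inj₂ q = inj₂ q
... | inj₁ p | inj₁ ps = inj₁ λ { zero → p ; (suc i) → ps i }

-- Existence and monotonicity of Ramsey numbers

Extensional : ∀ {A : Set} (_≈_ : A → A → Set) → (A → Set) → Set
Extensional _≈_ P = ∀ {x y} → x ≈ y → P x → P y

-- Without function extensionality only extensional predicates on a function space can be
-- decided by exhaustive search.
Searchable : (A : Set) (_≈_ : A → A → Set) → Set₁
Searchable A _≈_ = ∀ {P : A → Set} → Extensional _≈_ P → (∀ x → Dec (P x)) → Dec (Σ A P)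

Pointwise : ∀ {A : Set} (_≈_ : A → A → Set) {n} → (Fin n → A) → (Fin n → A) → Set
Pointwise _≈_ f g = ∀ i → f i ≈ g i

searchFin : ∀ {n} → Searchable (Fin n) _≡_
searchFin _ P? = Finₚ.any? P?

searchBool : Searchable Bool _≡_
searchBool _ P? with P? true | P? false
... | yes p | _ = yes (true , p)
... | no _ | yes q = yes (false , q)
... | no p | no q = no λ { (true , r) → p r ; (false , r) → q r }

-- Search for the value at `zero`, and inside it for the remaining function. Extensionality of the
-- predicate is what allows passing from `f` to the pointwise equal function `f zero ◂ (f ∘ suc)`.
searchFun : ∀ {A : Set} {_≈_ : A → A → Set} → (∀ {x} → x ≈ x) → Searchable A _≈_ →
            ∀ {n} → Searchable (Fin n → A) (Pointwise _≈_)
searchFun ≈-refl S {zero} ext P? with P? (λ ())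
... | yes p = yes (_ , p)
... | no ¬p = no λ { (f , q) → ¬p (ext (λ ()) q) }
searchFun {A} {_≈_} ≈-refl S {suc n} {P} ext P? =
  map′ (λ { (a , f , p) → a ◂ f , p })
       (λ { (f , p) → f zero , f ∘ suc , ext (λ { zero → ≈-refl ; (suc _) → ≈-refl }) p })
       (S (λ e → λ { (f , p) → f , ext (λ { zero → e ; (suc _) → ≈-refl }) p })
          (λ a → searchFun ≈-refl S {n} (λ e → ext (λ { zero → ≈-refl ; (suc i) → e i }))
                   (λ f → P? (a ◂ f))))

_≗₃_ : ∀ {N} → Colouring N → Colouring N → Set
_≗₃_ = Pointwise (Pointwise (Pointwise _≡_))

searchColouring : ∀ {N} → Searchable (Colouring N) _≗₃_
searchColouring = searchFun (λ _ _ → refl) (searchFun (λ _ → refl) (searchFun refl searchBool))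

injective? : ∀ {a b} (f : Fin a → Fin b) → Dec (Inj f)
injective? f = map′ (λ h {i} {j} → h i j) (λ h i j → h)
  (Finₚ.all? λ i → Finₚ.all? λ j → (f i Fin.≟ f j) →-dec (i Fin.≟ j))

Inj-ext : ∀ {a b} {f g : Fin a → Fin b} → f ≗ g → Inj f → Inj g
Inj-ext e h p = h (trans (e _) (trans p (sym (e _))))

redClique? : ∀ {N} (χ : Colouring N) s → Dec (RedClique χ s)
redClique? χ s = searchFun refl searchFin
  (λ {f} {g} e → λ { (inj , h) → Inj-ext e inj ,
     λ i j k a b c → trans (sym (trans (cong (λ v → χ v (f j) (f k)) (e i))
       (cong₂ (χ (g i)) (e j) (e k)))) (h i j k a b c) })
  (λ f → injective? f ×-dec
     (Finₚ.all? λ i → Finₚ.all? λ j → Finₚ.all? λ k →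
       ¬? (i Fin.≟ j) →-dec (¬? (j Fin.≟ k) →-dec (¬? (i Fin.≟ k) →-dec (_ Boolₚ.≟ true)))))

blueStar? : ∀ {N} (χ : Colouring N) n → Dec (BlueStar χ n)
blueStar? χ n = searchFin (λ { refl h → h }) λ v → searchFun refl searchFin
  (λ {f} {g} e → λ { (inj , av , h) → Inj-ext e inj , (λ i p → av i (trans (e i) p)) ,
     λ i j a → trans (sym (cong₂ (χ v) (e i) (e j))) (h i j a) })
  (λ g → injective? g ×-dec ((Finₚ.all? λ i → ¬? (g i Fin.≟ v)) ×-dec
     (Finₚ.all? λ i → Finₚ.all? λ j → ¬? (i Fin.≟ j) →-dec (_ Boolₚ.≟ false))))

Good : ∀ {N} → Colouring N → ℕ → ℕ → Set
Good χ s n = RedClique χ s ⊎ BlueStar χ n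

good? : ∀ {N} (χ : Colouring N) s n → Dec (Good χ s n)
good? χ s n = redClique? χ s ⊎-dec blueStar? χ n

symmetric? : ∀ {N} (χ : Colouring N) → Dec (Symmetric χ)
symmetric? χ = Finₚ.all? λ a → Finₚ.all? λ b → Finₚ.all? λ c →
  (_ Boolₚ.≟ _) ×-dec (_ Boolₚ.≟ _)

Good-ext : ∀ {N} {χ ψ : Colouring N} {s n} → χ ≗₃ ψ → Good χ s n → Good ψ s n
Good-ext e (inj₁ (f , inj , h)) = inj₁ (f , inj , λ i j k a b c → trans (sym (e _ _ _)) (h i j k a b c))
Good-ext e (inj₂ (v , g , inj , av , h)) = inj₂ (v , g , inj , av , λ i j a → trans (sym (e _ _ _)) (h i j a))

Symmetric-ext : ∀ {N} {χ ψ : Colouring N} → χ ≗₃ ψ → Symmetric χ → Symmetric ψ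
Symmetric-ext e h a b c =
  trans (sym (e _ _ _)) (trans (proj₁ (h a b c)) (e _ _ _)) ,
  trans (sym (e _ _ _)) (trans (proj₂ (h a b c)) (e _ _ _))

-- An exhaustive search for a bad colouring. Deciding this property is what makes the least such
-- `N`, the Ramsey number itself, available as a natural number.
arrows? : ∀ N s n → Dec (Arrows N s n)
arrows? N s n = map′ to from (¬? (searchColouring ext λ χ → symmetric? χ ×-dec ¬? (good? χ s n)))
  where
  Bad : Colouring N → Set
  Bad χ = Symmetric χ × ¬ Good χ s n
  ext : Extensional _≗₃_ Bad
  ext {χ} {ψ} e (h , ng) = Symmetric-ext {χ = χ} {ψ} e h ,
    λ g → ng (Good-ext {χ = ψ} {χ} (λ a b c → sym (e a b c)) g)
  to : ¬ Σ (Colouring N) Bad → Arrows N s n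
  to h χ sy = decidable-stable (good? χ s n) λ ng → h (χ , sy , ng)
  from : Arrows N s n → ¬ Σ (Colouring N) Bad
  from h (χ , sy , ng) = ng (h χ sy)

redClique-pull : ∀ {N M s} {χ : Colouring N} (ι : Fin M → Fin N) → Inj ι →
  RedClique (λ a b c → χ (ι a) (ι b) (ι c)) s → RedClique χ s
redClique-pull ι inj (f , fi , h) = ι ∘ f , (fi ∘ inj) , h

blueStar-pull : ∀ {N M n} {χ : Colouring N} (ι : Fin M → Fin N) → Inj ι →
  BlueStar (λ a b c → χ (ι a) (ι b) (ι c)) n → BlueStar χ n
blueStar-pull ι inj (v , g , gi , av , h) = ι v , ι ∘ g , (gi ∘ inj) , (λ i → av i ∘ inj) , h

arrows-mono : ∀ {M N s n} → M ≤ N → Arrows M s n → Arrows N s n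
arrows-mono {M} {N} {s} {n} le A χ sy with A (λ a b c → χ (ι a) (ι b) (ι c)) (λ a b c → sy _ _ _)
  where ι : Fin M → Fin N
        ι i = Fin.inject≤ i le
... | inj₁ c = inj₁ (redClique-pull {χ = χ} _ (λ {i} {j} → Finₚ.inject≤-injective le le i j) c)
... | inj₂ b = inj₂ (blueStar-pull {χ = χ} _ (λ {i} {j} → Finₚ.inject≤-injective le le i j) b)

least : ∀ {P : ℕ → Set} → (∀ n → Dec (P n)) → ∀ R → P R →
        ∃ λ r → P r × (∀ m → m < r → ¬ P m)
least P? zero p = zero , p , λ _ ()
least {P} P? (suc R) p with P? zero
... | yes q = zero , q , λ _ ()
... | no ¬q with least {P ∘ suc} (P? ∘ suc) R p
... | r , pr , h = suc r , pr , λ { zero _ → ¬q ; (suc m) (s≤s lt) → h m lt }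

ramsey-exists : ∀ R s n → Arrows R s n → ∃ (IsRamseyNumber s n)
ramsey-exists R s n = least (λ N → arrows? N s n) R

ramsey-≤ : ∀ {s n r R} → IsRamseyNumber s n r → Arrows R s n → r ≤ R
ramsey-≤ {r = r} {R} (_ , h) A with r ≤? R
... | yes p = p
... | no q = ⊥-elim (h R (≰⇒> q) A)

<-ramsey : ∀ {s n r N} → IsRamseyNumber s n r → ¬ Arrows N s n → N < r
<-ramsey {r = r} {N} (A , _) h with N <? r
... | yes p = p
... | no q = ⊥-elim (h (arrows-mono (≮⇒≥ q) A))

-- One vertex has no room for two clique vertices, nor for a centre and a leaf. The resulting bound
-- `2 ≤ r` settles the small cases of the lower bounds.
¬arrows-1 : ∀ s n → ¬ Arrows 1 (2 + s) (1 + n)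
¬arrows-1 s n A with A (λ _ _ _ → true) (λ _ _ _ → refl , refl)
... | inj₁ (f , inj , _) with f zero in p | f (suc zero) in q
... | zero | zero with () ← inj {zero} {suc zero} (trans p (sym q))
¬arrows-1 s n A | inj₂ (zero , g , _ , av , _) with g zero in p
... | zero = av zero p

-- The exponential upper bound

Inj-◂ : ∀ {k N} {v : Fin N} {f : Fin k → Fin N} → Inj f → (∀ i → f i ≢ v) → Inj (v ◂ f)
Inj-◂ inj av {zero} {zero} e = refl
Inj-◂ inj av {zero} {suc j} e = ⊥-elim (av j (sym e))
Inj-◂ inj av {suc i} {zero} e = ⊥-elim (av i e)
Inj-◂ inj av {suc i} {suc j} e = cong suc (inj e)

lookup-pairs : ∀ {A : Set} {R : A → A → Set} → (∀ {x y} → R x y → R y x) →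
  ∀ {xs} → AllPairs R xs → ∀ i j → i ≢ j → R (List.lookup xs i) (List.lookup xs j)
lookup-pairs sy (_ ∷ _) zero zero ne = ⊥-elim (ne refl)
lookup-pairs sy (a ∷ _) zero (suc j) ne = All.lookup a (∈-lookup j)
lookup-pairs sy (a ∷ _) (suc i) zero ne = sy (All.lookup a (∈-lookup i))
lookup-pairs sy (_ ∷ ps) (suc i) (suc j) ne = lookup-pairs sy ps i j (ne ∘ cong suc)

module _ {N : ℕ} (χ : Colouring N) (sy : Symmetric χ) where

  swap₁ : ∀ {a b c x} → χ a b c ≡ x → χ b a c ≡ x
  swap₁ h = trans (sym (proj₁ (sy _ _ _))) h

  swap₂ : ∀ {a b c x} → χ a b c ≡ x → χ a c b ≡ x
  swap₂ h = trans (sym (proj₂ (sy _ _ _))) h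

  LeafPair : Fin N → Fin N → Fin N → Set
  LeafPair v x y = x ≢ y × χ v x y ≡ false

  Leaf : ∀ {M} → Fin N → (Fin M → Fin N) → Fin N → Set
  Leaf v W x = x ≢ v × ∀ w → LeafPair v x (W w)

  record State (k M : ℕ) : Set where
    field
      core : Fin k → Fin N
      leaves : Fin k → List (Fin N)
      pool : Fin M → Fin N
      core-inj : Inj core
      pool-inj : Inj pool
      core≢pool : ∀ i w → core i ≢ pool w
      core-red : ∀ i j l → i ≢ j → j ≢ l → i ≢ l → χ (core i) (core j) (core l) ≡ true
      pool-red : ∀ i j → i ≢ j → ∀ w → χ (core i) (core j) (pool w) ≡ true
      leaf-pairs : ∀ i → AllPairs (LeafPair (core i)) (leaves i)
      leaf-pool : ∀ i → All (Leaf (core i) pool) (leaves i)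

    -- Core vertices and leaves counted together: it grows by exactly one in every round, whichever
    -- way the new vertex is used.
    size : ℕ
    size = sum (λ i → suc (length (leaves i)))

  open State

  star : ∀ {k M n} (S : State k M) i → n ≤ length (leaves S i) → BlueStar χ n
  star {n = n} S i le = core S i , (λ a → List.lookup L (Fin.inject≤ a le)) ,
      (λ {a} {b} e → inj a b e) ,
      (λ a → proj₁ (All.lookup (leaf-pool S i) (∈-lookup _))) ,
      (λ a b ne → proj₂ (pair a b ne))
    where
    L = leaves S i
    pair : ∀ a b → a ≢ b →
      LeafPair (core S i) (List.lookup L (Fin.inject≤ a le)) (List.lookup L (Fin.inject≤ b le))
    pair a b ne = lookup-pairs (λ { (p , q) → (p ∘ sym) , swap₂ q }) (leaf-pairs S i)
      _ _ (ne ∘ Finₚ.inject≤-injective le le a b)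
    inj : ∀ a b → List.lookup L (Fin.inject≤ a le) ≡ List.lookup L (Fin.inject≤ b le) → a ≡ b
    inj a b e with a Fin.≟ b
    ... | yes p = p
    ... | no ne = ⊥-elim (proj₁ (pair a b ne) e)

  restrict : ∀ {k M M′} → State k M → (ι : Fin M′ → Fin M) → Inj ι → State k M′
  restrict S ι inj = record
    { core = core S ; leaves = leaves S ; pool = pool S ∘ ι
    ; core-inj = core-inj S ; pool-inj = inj ∘ pool-inj S
    ; core≢pool = λ i w → core≢pool S i (ι w)
    ; core-red = core-red S ; pool-red = λ i j ne w → pool-red S i j ne (ι w)
    ; leaf-pairs = leaf-pairs S
    ; leaf-pool = λ i → All.map (λ { (p , q) → p , q ∘ ι }) (leaf-pool S i) }

  extend-core : ∀ {k M} (S : State k (suc M)) →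
    (∀ j i → χ (core S i) (pool S zero) (pool S (suc j)) ≡ true) → State (suc k) M
  extend-core S h = record
    { core = w ◂ core S ; leaves = [] ◂ leaves S ; pool = pool S ∘ suc
    ; core-inj = Inj-◂ (core-inj S) (λ i → core≢pool S i zero)
    ; pool-inj = λ e → Finₚ.suc-injective (pool-inj S e)
    ; core≢pool = λ { zero j e → Finₚ.0≢1+n (pool-inj S e) ; (suc i) j → core≢pool S i (suc j) }
    ; core-red = red
    ; pool-red = λ { zero zero ne → ⊥-elim (ne refl)
                   ; zero (suc j) ne v → swap₁ (h v j)
                   ; (suc i) zero ne v → h v i
                   ; (suc i) (suc j) ne v → pool-red S i j (ne ∘ cong suc) (suc v) }
    ; leaf-pairs = λ { zero → [] ; (suc i) → leaf-pairs S i }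
    ; leaf-pool = λ { zero → [] ; (suc i) → All.map (λ { (p , q) → p , q ∘ suc }) (leaf-pool S i) } }
    where
    w = pool S zero
    red : ∀ i j l → i ≢ j → j ≢ l → i ≢ l → χ ((w ◂ core S) i) ((w ◂ core S) j) ((w ◂ core S) l) ≡ true
    red zero zero l a b c = ⊥-elim (a refl)
    red zero (suc j) zero a b c = ⊥-elim (c refl)
    red zero (suc j) (suc l) a b c = swap₁ (swap₂ (pool-red S j l (b ∘ cong suc) zero))
    red (suc i) zero zero a b c = ⊥-elim (b refl)
    red (suc i) zero (suc l) a b c = swap₂ (pool-red S i l (c ∘ cong suc) zero)
    red (suc i) (suc j) zero a b c = pool-red S i j (a ∘ cong suc) zero
    red (suc i) (suc j) (suc l) a b c = core-red S i j l (a ∘ cong suc) (b ∘ cong suc) (c ∘ cong suc)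

  push : ∀ {k} {A : Set} → (Fin k → List A) → Fin k → A → Fin k → List A
  push g i w j with j Fin.≟ i
  ... | yes _ = w ∷ g j
  ... | no _ = g j

  push-size : ∀ {k} {A : Set} (g : Fin k → List A) i w →
    sum (λ j → suc (length (push g i w j))) ≡ suc (sum (λ j → suc (length (g j))))
  push-size {suc k} g zero w = refl
  push-size {suc k} g (suc i) w = trans (cong (suc (length (g zero)) +_)
     (trans (sum-cong-≗ +-*-semiring (λ j → cong (suc ∘ length) (shift j))) (push-size (g ∘ suc) i w)))
     (+-suc (suc (length (g zero))) _)
    where
    shift : ∀ j → push g (suc i) w (suc j) ≡ push (g ∘ suc) i w j
    shift j with j Fin.≟ i
    ... | yes _ = refl
    ... | no _ = refl

  extend-star : ∀ {k M} (S : State k (suc M)) i →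
    (∀ j → χ (core S i) (pool S zero) (pool S (suc j)) ≡ false) → State k M
  extend-star {k} S i h = record
    { core = core S ; leaves = push (leaves S) i w ; pool = pool S ∘ suc
    ; core-inj = core-inj S ; pool-inj = λ e → Finₚ.suc-injective (pool-inj S e)
    ; core≢pool = λ i w → core≢pool S i (suc w)
    ; core-red = core-red S ; pool-red = λ i j ne w → pool-red S i j ne (suc w)
    ; leaf-pairs = pairs ; leaf-pool = lp }
    where
    w = pool S zero
    old : ∀ j → All (Leaf (core S j) (pool S ∘ suc)) (leaves S j)
    old j = All.map (λ { (p , q) → p , q ∘ suc }) (leaf-pool S j)
    pairs : ∀ j → AllPairs (LeafPair (core S j)) (push (leaves S) i w j)
    pairs j with j Fin.≟ i
    ... | yes refl = All.map (λ { (p , q) → (proj₁ (q zero) ∘ sym) , swap₂ (proj₂ (q zero)) }) (leaf-pool S j)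
                     ∷ leaf-pairs S j
    ... | no _ = leaf-pairs S j
    lp : ∀ j → All (Leaf (core S j) (pool S ∘ suc)) (push (leaves S) i w j)
    lp j with j Fin.≟ i
    ... | yes refl = ((λ e → core≢pool S j zero (sym e)) ,
                      λ v → (λ e → Finₚ.0≢1+n (pool-inj S e)) , h v) ∷ old j
    ... | no _ = old j

  -- Class `zero` records that the pair is red with every core vertex, so the new vertex may join
  -- the core; class `suc i` names a core vertex for which it becomes a leaf.
  colour-class : ∀ {k} → (Fin k → Bool) → Fin (suc k)
  colour-class b with Finₚ.any? (λ i → b i Boolₚ.≟ false)
  ... | yes (i , _) = suc i
  ... | no _ = zero

  class-zero : ∀ {k} (b : Fin k → Bool) → colour-class b ≡ zero → ∀ i → b i ≡ true
  class-zero b e i with Finₚ.any? (λ i → b i Boolₚ.≟ false)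
  ... | no h with b i in eq
  ... | true = refl
  ... | false = ⊥-elim (h (i , eq))

  class-suc : ∀ {k} (b : Fin k → Bool) {i} → colour-class b ≡ suc i → b i ≡ false
  class-suc b e with Finₚ.any? (λ i → b i Boolₚ.≟ false)
  class-suc b refl | yes (i , h) = h

  module _ (s n : ℕ) (1≤n : 1 ≤ n) where

    -- Every round consumes one pool vertex, which either joins the red core or becomes a leaf
    -- of a blue star centred in the core; the pool shrinks by a factor of at most s + 1.
    grow : ∀ B {k M} (S : State k M) → k < s → (∀ i → length (leaves S i) < n) →
           s * suc n ≤ B + size S → suc s ^ B ≤ M → Good χ s n
    -- With the budget spent, core and leaves number at least `s * suc n`, more than fewer than `s`
    -- core vertices with fewer than `n` leaves each can account for.
    grow zero {k} S k<s short budget big = ⊥-elim (<-irrefl refl (begin-strict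
        s * suc n ≤⟨ budget ⟩
        size S    ≤⟨ sum-≤ short ⟩
        k * n     ≤⟨ *-monoʳ-≤ k (n≤1+n n) ⟩
        k * suc n <⟨ *-monoˡ-< (suc n) k<s ⟩
        s * suc n ∎))
      where open ≤-Reasoning
    grow (suc B) {k} {zero} S k<s short budget big =
      ⊥-elim (<-irrefl refl (<-≤-trans (m^n>0 (suc s) (suc B)) big))
    grow (suc B) {k} {suc M} S k<s short budget big
      with pigeonhole (suc s ^ B) (s≤s z≤n)
             (λ j → colour-class (λ i → χ (core S i) (pool S zero) (pool S (suc j))))
             -- Of the `suc s` blocks of size `suc s ^ B` in the pool, one pays for the vertex
             -- removed, and the other `s` suffice for the `suc k ≤ s` classes.
             (≤-trans (*-monoˡ-≤ (suc s ^ B) k<s)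
               (≤-pred (≤-trans (+-monoˡ-≤ _ (m^n>0 (suc s) B)) big)))
    ... | zero , ι , inj , h = next (k<s)
      where
      T : State (suc k) (suc s ^ B)
      T = extend-core (restrict S (zero ◂ (suc ∘ ι)) (Inj-◂ (inj ∘ Finₚ.suc-injective) (λ _ ())))
            (λ j i → class-zero _ (h j) i)
      next : suc k ≤ s → Good χ s n
      next le with m≤n⇒m<n∨m≡n le
      ... | inj₁ lt = grow B T lt (λ { zero → 1≤n ; (suc i) → short i })
                        (≤-trans budget (≤-reflexive (sym (+-suc B _)))) ≤-refl
      ... | inj₂ refl = inj₁ (core T , core-inj T , core-red T)
    ... | suc i , ι , inj , h = next
      where
      T : State k (suc s ^ B)
      T = extend-star (restrict S (zero ◂ (suc ∘ ι)) (Inj-◂ (inj ∘ Finₚ.suc-injective) (λ _ ())))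
            i (λ j → class-suc _ (h j))
      next : Good χ s n
      next with n ≤? length (leaves T i)
      ... | yes le = inj₂ (star T i le)
      ... | no nle = grow B T k<s short′ (≤-trans budget (≤-reflexive
               (trans (sym (+-suc B _)) (cong (B +_) (sym (push-size (leaves S) i _)))))) ≤-refl
        where
        short′ : ∀ j → length (leaves T j) < n
        short′ j with j Fin.≟ i in eq
        ... | no _ = short j
        ... | yes refl rewrite eq with j Fin.≟ j
        ...   | yes _ = ≰⇒> nle
        ...   | no ne = ⊥-elim (ne refl)

arrows-exponential : ∀ s n → 1 ≤ s → 1 ≤ n → Arrows (suc s ^ (s * suc n)) s n
arrows-exponential s n 1≤s 1≤n χ sy = grow χ sy s n 1≤n (s * suc n) init 1≤s (λ ())
    (m≤m+n _ _) ≤-refl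
  where
  init : State χ sy 0 (suc s ^ (s * suc n))
  init = record
    { core = λ () ; leaves = λ () ; pool = id ; core-inj = λ { {()} } ; pool-inj = id
    ; core≢pool = λ () ; core-red = λ () ; pool-red = λ () ; leaf-pairs = λ () ; leaf-pool = λ () }

-- The subexponential upper bound for s = 4

Graph : ℕ → Set
Graph M = Fin M → Fin M → Bool

Homogeneous : ∀ {M} → Graph M → Bool → ℕ → Set
Homogeneous {M} R c k = Σ (Fin k → Fin M) λ f → Inj f × ∀ i j → i ≢ j → R (f i) (f j) ≡ c

homogeneous-cons : ∀ {M k c} {R : Graph (suc M)} → (∀ i j → R i j ≡ R j i) →
  (f : Fin k → Fin M) → Inj f → (∀ i j → i ≢ j → R (suc (f i)) (suc (f j)) ≡ c) →
  (∀ i → R zero (suc (f i)) ≡ c) → Homogeneous R c (suc k)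
homogeneous-cons {c = c} {R} sy f inj h h₀ =
  zero ◂ (suc ∘ f) , Inj-◂ (inj ∘ Finₚ.suc-injective) (λ _ ()) , hom
  where
  hom : ∀ i j → i ≢ j → R ((zero ◂ (suc ∘ f)) i) ((zero ◂ (suc ∘ f)) j) ≡ c
  hom zero zero ne = ⊥-elim (ne refl)
  hom zero (suc j) ne = h₀ j
  hom (suc i) zero ne = trans (sy _ _) (h₀ i)
  hom (suc i) (suc j) ne = h i j (ne ∘ cong suc)

homogeneous-pull : ∀ {M M′ c k} {R : Graph M} (ι : Fin M′ → Fin M) → Inj ι →
  Homogeneous (λ x y → R (ι x) (ι y)) c k → Homogeneous R c k
homogeneous-pull ι inj (f , fi , h) = ι ∘ f , (fi ∘ inj) , h

not-true : ∀ {b} → not b ≡ true → b ≡ false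
not-true {false} _ = refl

not-false : ∀ {b} → not b ≡ false → b ≡ true
not-false {true} _ = refl

-- The Erdős-Szekeres recursion on the two neighbourhoods of a vertex, with the cruder bound
-- `n ^ s`, for which `suc n ^ suc s ≥ suc n ^ s + n ^ suc s` is immediate.
graph-ramsey : ∀ s n {M} (R : Graph M) → (∀ i j → R i j ≡ R j i) → n ^ s ≤ M →
               Homogeneous R true s ⊎ Homogeneous R false n
graph-ramsey zero n R sy le = inj₁ ((λ ()) , (λ { {()} }) , λ ())
graph-ramsey (suc s) zero R sy le = inj₂ ((λ ()) , (λ { {()} }) , λ ())
graph-ramsey (suc s) (suc n) {zero} R sy le =
  ⊥-elim (<-irrefl refl (<-≤-trans (m^n>0 (suc n) (suc s)) le))
graph-ramsey (suc s) (suc n) {suc M} R sy le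
  with split (suc n ^ s) (n ^ suc s) (λ i → R zero (suc i))
         (≤-trans (+-monoʳ-≤ (suc n ^ s) (*-monoʳ-≤ n (^-monoˡ-≤ s (n≤1+n n)))) le)
... | inj₁ (ι , inj , red) with graph-ramsey s (suc n) (λ x y → R (suc (ι x)) (suc (ι y))) (λ _ _ → sy _ _) ≤-refl
...   | inj₁ (f , fi , h) = inj₁ (homogeneous-cons sy (ι ∘ f) (fi ∘ inj) h (red ∘ f))
...   | inj₂ H = inj₂ (homogeneous-pull {R = R} (suc ∘ ι) (inj ∘ Finₚ.suc-injective) H)
graph-ramsey (suc s) (suc n) {suc M} R sy le
    | inj₂ (ι , inj , blue) with graph-ramsey (suc s) n (λ x y → R (suc (ι x)) (suc (ι y))) (λ _ _ → sy _ _) ≤-refl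
...   | inj₁ H = inj₁ (homogeneous-pull {R = R} (suc ∘ ι) (inj ∘ Finₚ.suc-injective) H)
...   | inj₂ (f , fi , h) = inj₂ (homogeneous-cons sy (ι ∘ f) (fi ∘ inj) h (not-true ∘ blue ∘ f))

markov : ∀ {M} (f : Fin M → ℕ) t (p : Fin M → Bool) → (∀ i → p i ≡ true → t ≤ f i) →
         t * count p ≤ sum f
markov f t p h = ≤-trans (≤-reflexive (*-distribˡ-sum t (𝟙 ∘ p))) (sum-mono λ i → lemma i)
  where
  lemma : ∀ i → t * 𝟙 (p i) ≤ f i
  lemma i with p i in eq
  ... | true = ≤-trans (≤-reflexive (*-identityʳ t)) (h i eq)
  ... | false = ≤-trans (≤-reflexive (*-zeroʳ t)) z≤n

image-count : ∀ {τ c} (h : Fin c → Fin (suc τ)) →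
              count (λ t → ⌊ Finₚ.any? (λ j → h j Fin.≟ suc t) ⌋) ≤ c
image-count {τ} {c} h = Finₚ.injective⇒≤ {f = g} g-inj
  where
  p : Fin τ → Bool
  p t = ⌊ Finₚ.any? (λ j → h j Fin.≟ suc t) ⌋
  witness : ∀ t → p t ≡ true → ∃ λ j → h j ≡ suc t
  witness t = true-⌊⌋ (Finₚ.any? (λ j → h j Fin.≟ suc t))
  sel = select p ≤-refl
  g : Fin (count p) → Fin c
  g i = proj₁ (witness _ (proj₂ (proj₂ sel) i))
  g-inj : Inj g
  g-inj {i} {j} e = proj₁ (proj₂ sel) (Finₚ.suc-injective
    (trans (sym (proj₂ (witness _ (proj₂ (proj₂ sel) i))))
      (trans (cong h e) (proj₂ (witness _ (proj₂ (proj₂ sel) j))))))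

-- A set of at most `c` elements of `Fin τ` is covered by the values of one of `suc τ ^ c`
-- functions, the extra value being junk. The pigeonhole principle makes this function the same for
-- `a` of the sets.
common-cover : ∀ {K τ c a} (nb : Fin K → Fin τ → Bool) → (∀ i → count (nb i) ≤ c) →
  suc τ ^ c * a ≤ K →
  Σ (Fin c → Fin (suc τ)) λ h → Σ (Fin a → Fin K) λ ρ → Inj ρ ×
    (∀ i t → nb (ρ i) t ≡ true → ∃ λ j → h j ≡ suc t)
common-cover {K} {τ} {c} {a} nb few le
  with pigeonhole a (m^n>0 (suc τ) c) (λ i → funToFin (proj₁ (cover (nb i) (few i)))) le
... | e , ρ , inj , same = finToFun e , ρ , inj , λ i t r →
  let j , q = proj₂ (cover (nb (ρ i)) (few (ρ i))) t r in
  j , trans (cong (λ z → finToFun z j) (sym (same i)))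
        (trans (Finₚ.finToFun-funToFin (proj₁ (cover (nb (ρ i)) (few (ρ i)))) j) q)

uncovered : ∀ {τ c} (h : Fin c → Fin (suc τ)) →
  Σ (Fin (τ ∸ c) → Fin τ) λ κ → Inj κ × ∀ a j → h j ≢ suc (κ a)
uncovered {τ} {c} h with select (not ∘ covered) enough
  where
  covered : Fin τ → Bool
  covered t = ⌊ Finₚ.any? (λ j → h j Fin.≟ suc t) ⌋
  enough : τ ∸ c ≤ count (not ∘ covered)
  enough = m≤n+o⇒m∸n≤o τ c (≤-trans (≤-reflexive (sym (count-not covered)))
             (+-monoˡ-≤ _ (image-count h)))
... | κ , inj , ok = κ , inj , avoids
  where
  avoids : ∀ a j → h j ≢ suc (κ a)
  avoids a j e with Finₚ.any? (λ j → h j Fin.≟ suc (κ a)) | ok a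
  ... | no ¬w | _ = ¬w (j , e)

-- The Erdős–Szemerédi theorem: a graph of density O(1/s) has a homogeneous set much larger than
-- guaranteed by Ramsey's theorem.  If T is an independent set of low-degree vertices, many
-- vertices have at most c neighbours in T, hence many have their neighbours in the same c
-- elements of T; trading these elements for an independent (c + 1)-set of such vertices enlarges T.
-- Loops are present at every vertex, so that a vertex non-adjacent to a set lies outside it.
module _ {M : ℕ} (G : Graph M) (sy : ∀ i j → G i j ≡ G j i) (loop : ∀ i → G i i ≡ true)
         (s c n : ℕ) (1≤n : 1 ≤ n) (sc : 16 * n ≤ s * c)
         (sparse : s * sum (λ i → count (G i)) ≤ 2 * (M * M))
         (large : 4 * (n ^ c * n ^ suc c) ≤ M) where

  low : Fin M → Bool
  low i = ⌊ s * count (G i) ≤? 4 * M ⌋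

  low-true : ∀ i → low i ≡ true → s * count (G i) ≤ 4 * M
  low-true i = true-⌊⌋ (s * count (G i) ≤? 4 * M)

  low-false : ∀ i → low i ≡ false → 4 * M ≤ s * count (G i)
  low-false i e = <⇒≤ (≰⇒> (false-⌊⌋ (s * count (G i) ≤? 4 * M) e))

  1≤M : 1 ≤ M
  1≤M = ≤-trans (*-mono-≤ {1} {4} (s≤s z≤n) (*-mono-≤ (1≤pow c) (1≤pow (suc c)))) large
    where
    1≤pow : ∀ e → 1 ≤ n ^ e
    1≤pow e = m^n>0 n ⦃ >-nonZero 1≤n ⦄ e

  -- The average degree is at most `2 M / s`, so by Markov's inequality at most half of the vertices
  -- exceed twice that.
  half-low : M ≤ 2 * count low
  half-low = +-cancelʳ-≤ (2 * count (not ∘ low)) M (2 * count low) (begin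
      M + 2 * count (not ∘ low)         ≤⟨ +-monoʳ-≤ M few-high ⟩
      M + M                              ≡⟨ cong (λ x → x + x) (count-not low) ⟨
      (count low + count (not ∘ low)) + (count low + count (not ∘ low)) ≡⟨ arith (count low) (count (not ∘ low)) ⟩
      2 * count low + 2 * count (not ∘ low) ∎)
    where
    open ≤-Reasoning
    arith : ∀ a b → (a + b) + (a + b) ≡ 2 * a + 2 * b
    arith = solve-∀
    arith₂ : ∀ a m → 2 * m * (2 * a) ≡ 4 * m * a
    arith₂ = solve-∀
    arith₃ : ∀ m → 2 * (m * m) ≡ 2 * m * m
    arith₃ = solve-∀
    few-high : 2 * count (not ∘ low) ≤ M
    few-high = *-cancelˡ-≤ {2 * count (not ∘ low)} {M} (2 * M) ⦃ >-nonZero (≤-trans 1≤M (m≤m+n M _)) ⦄ (begin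
      2 * M * (2 * count (not ∘ low)) ≡⟨ arith₂ (count (not ∘ low)) M ⟩
      4 * M * count (not ∘ low)       ≤⟨ markov _ (4 * M) (not ∘ low) (λ i e → low-false i (not-true e)) ⟩
      sum (λ i → s * count (G i))     ≡⟨ *-distribˡ-sum s (count ∘ G) ⟨
      s * sum (count ∘ G)             ≤⟨ sparse ⟩
      2 * (M * M)                     ≡⟨ arith₃ M ⟩
      2 * M * M                       ∎)

  -- Injectivity is implied: two equal vertices at distinct indices would be adjacent by `loop`.
  LowIndependent : ℕ → Set
  LowIndependent τ = Σ (Fin τ → Fin M) λ ι →
    (∀ i j → i ≢ j → G (ι i) (ι j) ≡ false) × (∀ i → low (ι i) ≡ true)

  FewNeighbours : ∀ {τ} → (Fin τ → Fin M) → Set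
  FewNeighbours ι = Σ (Fin (n ^ c * n ^ suc c) → Fin M) λ ξ → Inj ξ ×
    (∀ i → low (ξ i) ≡ true) × (∀ i → count (λ t → G (ξ i) (ι t)) ≤ c)

  -- The at most `n` low vertices `ι t` have total degree at most `n * (4 * M) / s`. As
  -- `16 * n ≤ s * c`, at most a quarter of all vertices see more than `c` of them; since half of
  -- all vertices are low, a quarter of `M` remains.
  few-neighbours : ∀ {τ} → τ ≤ n → (ι : Fin τ → Fin M) → (∀ t → low (ι t) ≡ true) → FewNeighbours ι
  few-neighbours {τ} τ≤n ι lw = finish (select X X-large)
    where
    open ≤-Reasoning
    nbrs : Fin M → ℕ
    nbrs x = count (λ t → G x (ι t))
    few : Fin M → Bool
    few x = ⌊ nbrs x ≤? c ⌋
    few-true : ∀ x → few x ≡ true → nbrs x ≤ c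
    few-true x = true-⌊⌋ (nbrs x ≤? c)
    few-false : ∀ x → few x ≡ false → c ≤ nbrs x
    few-false x e = <⇒≤ (≰⇒> (false-⌊⌋ (nbrs x ≤? c) e))

    nbrs-sum : s * sum nbrs ≤ n * (4 * M)
    nbrs-sum = begin
      s * sum nbrs ≡⟨ cong (s *_) (∑-comm +-*-semiring (λ x t → 𝟙 (G x (ι t)))) ⟩
      s * sum (λ t → sum (λ x → 𝟙 (G x (ι t)))) ≡⟨ *-distribˡ-sum s (λ t → sum (λ x → 𝟙 (G x (ι t)))) ⟩
      sum (λ t → s * sum (λ x → 𝟙 (G x (ι t))))
        ≤⟨ sum-≤ (λ t → subst (λ d → s * d ≤ 4 * M)
             (sum-cong-≗ +-*-semiring (λ x → cong 𝟙 (sy (ι t) x))) (low-true _ (lw t))) ⟩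
      τ * (4 * M) ≤⟨ *-monoˡ-≤ (4 * M) τ≤n ⟩
      n * (4 * M) ∎

    many-few : 4 * count (not ∘ few) ≤ M
    many-few = *-cancelˡ-≤ {4 * count (not ∘ few)} {M} (4 * n) ⦃ >-nonZero (≤-trans 1≤n (m≤m+n n _)) ⦄ (begin
      4 * n * (4 * count (not ∘ few)) ≡⟨ a₁ n (count (not ∘ few)) ⟩
      16 * n * count (not ∘ few)      ≤⟨ *-monoˡ-≤ (count (not ∘ few)) sc ⟩
      s * c * count (not ∘ few)       ≡⟨ *-assoc s c (count (not ∘ few)) ⟩
      s * (c * count (not ∘ few))     ≤⟨ *-monoʳ-≤ s (markov nbrs c (not ∘ few) (λ x e → few-false x (not-true e))) ⟩
      s * sum nbrs                    ≤⟨ nbrs-sum ⟩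
      n * (4 * M)                     ≡⟨ a₂ n M ⟩
      4 * n * M                       ∎)
      where
      a₁ : ∀ x y → 4 * x * (4 * y) ≡ 16 * x * y
      a₁ = solve-∀
      a₂ : ∀ x y → x * (4 * y) ≡ 4 * x * y
      a₂ = solve-∀

    X : Fin M → Bool
    X x = low x ∧ few x

    low≤X : count low ≤ count X + count (not ∘ few)
    low≤X = ≤-trans (sum-mono pointwise) (≤-reflexive (∑-distrib-+ +-*-semiring (𝟙 ∘ X) (𝟙 ∘ not ∘ few)))
      where
      pointwise : ∀ x → 𝟙 (low x) ≤ 𝟙 (low x ∧ few x) + 𝟙 (not (few x))
      pointwise x with low x | few x
      ... | false | _ = z≤n
      ... | true | true = s≤s z≤n
      ... | true | false = s≤s z≤n

    X-large : n ^ c * n ^ suc c ≤ count X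
    X-large = *-cancelˡ-≤ {n ^ c * n ^ suc c} {count X} 4 (≤-trans large (+-cancelʳ-≤ M M (4 * count X) (begin
      M + M                                   ≤⟨ +-mono-≤ half-low half-low ⟩
      2 * count low + 2 * count low           ≡⟨ a₁ (count low) ⟩
      4 * count low                           ≤⟨ *-monoʳ-≤ 4 low≤X ⟩
      4 * (count X + count (not ∘ few))       ≡⟨ *-distribˡ-+ 4 (count X) (count (not ∘ few)) ⟩
      4 * count X + 4 * count (not ∘ few)     ≤⟨ +-monoʳ-≤ (4 * count X) many-few ⟩
      4 * count X + M                         ∎)))
      where
      a₁ : ∀ x → 2 * x + 2 * x ≡ 4 * x
      a₁ = solve-∀

    finish : Selection X (n ^ c * n ^ suc c) → FewNeighbours ι
    finish (ξ , inj , ok) = ξ , inj , (λ i → proj₁ (both i)) , λ i → few-true _ (proj₂ (both i))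
      where
      both : ∀ i → low (ξ i) ≡ true × few (ξ i) ≡ true
      both i with low (ξ i) | ok i
      ... | true | e = refl , e

  -- The `τ ∸ c` vertices kept and the `suc c` new ones number at least `suc τ`, also when `c`
  -- exceeds `τ`; `emb` discards the surplus.
  glue : ∀ {τ} → (S : Fin (suc c) → Fin M) (κ : Fin (τ ∸ c) → Fin τ) → Inj κ →
    (I : LowIndependent τ) → (∀ x → low (S x) ≡ true) →
    (∀ x y → x ≢ y → G (S x) (S y) ≡ false) →
    (∀ x a → G (S x) (proj₁ I (κ a)) ≡ false) → LowIndependent (suc τ)
  glue {τ} S κ κ-inj (ι , ind , lw) S-low S-ind apart =
      join ∘ emb , (λ i j ne → independent _ _ (ne ∘ Finₚ.inject≤-injective le le i j)) , lows ∘ emb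
    where
    le : suc τ ≤ τ ∸ c + suc c
    le = ≤-trans (s≤s (m≤n+m∸n τ c)) (≤-reflexive (trans (cong suc (+-comm c _)) (sym (+-suc (τ ∸ c) c))))
    emb : Fin (suc τ) → Fin (τ ∸ c + suc c)
    emb i = Fin.inject≤ i le
    branch : Fin (τ ∸ c) ⊎ Fin (suc c) → Fin M
    branch (inj₁ a) = ι (κ a)
    branch (inj₂ x) = S x
    join : Fin (τ ∸ c + suc c) → Fin M
    join i = branch (Fin.splitAt (τ ∸ c) i)
    branch-ind : ∀ u v → u ≢ v → G (branch u) (branch v) ≡ false
    branch-ind (inj₁ a) (inj₁ b) ne = ind _ _ (λ e → ne (cong inj₁ (κ-inj e)))
    branch-ind (inj₁ a) (inj₂ y) ne = trans (sy _ _) (apart y a)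
    branch-ind (inj₂ x) (inj₁ b) ne = apart x b
    branch-ind (inj₂ x) (inj₂ y) ne = S-ind x y (ne ∘ cong inj₂)
    independent : ∀ i j → i ≢ j → G (join i) (join j) ≡ false
    independent i j ne = branch-ind (Fin.splitAt (τ ∸ c) i) (Fin.splitAt (τ ∸ c) j) λ e → ne
      (trans (sym (Finₚ.join-splitAt (τ ∸ c) (suc c) i))
        (trans (cong (Fin.join (τ ∸ c) (suc c)) e) (Finₚ.join-splitAt (τ ∸ c) (suc c) j)))
    lows : ∀ i → low (join i) ≡ true
    lows i with Fin.splitAt (τ ∸ c) i
    ... | inj₁ a = lw (κ a)
    ... | inj₂ x = S-low x

  -- There are at most `n ^ c` possible covers, so `n ^ suc c` of the vertices from `few-neighbours`
  -- share one. Ramsey's theorem for the complement of `G` among these gives a clique of size `n` or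
  -- an independent set of size `suc c`, which is non-adjacent to everything outside the cover and
  -- replaces what lies inside.
  enlarge : ∀ {τ} → suc τ ≤ n → LowIndependent τ → Homogeneous G true n ⊎ LowIndependent (suc τ)
  enlarge {τ} τ<n I@(ι , ind , lw) = step₁ (few-neighbours (<⇒≤ τ<n) ι lw)
    where
    Goal = Homogeneous G true n ⊎ LowIndependent (suc τ)
    step₁ : FewNeighbours ι → Goal
    step₁ (ξ , ξ-inj , ξ-low , ξ-few) = step₂ (common-cover (λ i t → G (ξ i) (ι t)) ξ-few
           (*-monoˡ-≤ (n ^ suc c) (^-monoˡ-≤ c τ<n)))
      where
      step₂ : (Σ (Fin c → Fin (suc τ)) λ h → Σ (Fin (n ^ suc c) → _) λ ρ → Inj ρ ×
        (∀ i t → G (ξ (ρ i)) (ι t) ≡ true → ∃ λ j → h j ≡ suc t)) → Goal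
      step₂ (h , ρ , ρ-inj , covers) = step₃ (uncovered h)
          (graph-ramsey (suc c) n (λ x y → not (G (ξ (ρ x)) (ξ (ρ y)))) (λ x y → cong not (sy _ _)) ≤-refl)
        where
        step₃ : (Σ (Fin (τ ∸ c) → Fin τ) λ κ → Inj κ × ∀ a j → h j ≢ suc (κ a)) →
          Homogeneous (λ x y → not (G (ξ (ρ x)) (ξ (ρ y)))) true (suc c) ⊎
          Homogeneous (λ x y → not (G (ξ (ρ x)) (ξ (ρ y)))) false n → Goal
        step₃ _ (inj₂ (f , f-inj , hom)) = inj₁ (ξ ∘ ρ ∘ f , (λ e → f-inj (ρ-inj (ξ-inj e))) ,
                                                 λ i j ne → not-false (hom i j ne))
        step₃ (κ , κ-inj , avoids) (inj₁ (f , f-inj , hom)) =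
            inj₂ (glue (ξ ∘ ρ ∘ f) κ κ-inj I (λ x → ξ-low _) (λ x y ne → not-true (hom x y ne)) apart)
          where
          apart : ∀ x a → G (ξ (ρ (f x))) (ι (κ a)) ≡ false
          apart x a with G (ξ (ρ (f x))) (ι (κ a)) in eq
          ... | false = refl
          ... | true = let j , q = covers (f x) (κ a) eq in ⊥-elim (avoids a j q)

  low-independent : ∀ τ → τ ≤ n → Homogeneous G true n ⊎ LowIndependent τ
  low-independent zero _ = inj₂ ((λ ()) , (λ ()) , λ ())
  low-independent (suc τ) le = [ inj₁ , enlarge le ]′ (low-independent τ (<⇒≤ le))

  sparse-homogeneous : Homogeneous G true n ⊎ Homogeneous G false n
  sparse-homogeneous = map₂ independent (low-independent n ≤-refl)
    where
    independent : LowIndependent n → Homogeneous G false n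
    independent (ι , ind , _) = ι , inj , ind
      where
      inj : Inj ι
      inj {i} {j} e with i Fin.≟ j
      ... | yes p = p
      ... | no ne with () ← trans (sym (loop (ι j))) (trans (cong (λ z → G z (ι j)) (sym e)) (ind i j ne))

-- Disjoint red links over a common pool

another : ∀ {n} → 2 ≤ n → (i : Fin n) → ∃ λ j → i ≢ j
another (s≤s (s≤s _)) zero = suc zero , λ ()
another (s≤s (s≤s _)) (suc _) = zero , λ ()

module _ {N : ℕ} (χ : Colouring N) (sy : Symmetric χ) where

  private
    rot : ∀ {a b c x} → χ a b c ≡ x → χ b c a ≡ x
    rot h = swap₂ χ sy (swap₁ χ sy h)

  redClique-cons : ∀ {k} v (R : RedClique χ k) → (∀ i → proj₁ R i ≢ v) →
    (∀ i j → i ≢ j → χ v (proj₁ R i) (proj₁ R j) ≡ true) → RedClique χ (suc k)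
  redClique-cons v (f , inj , red) av h = v ◂ f , Inj-◂ inj av , red′
    where
    red′ : ∀ i j k → i ≢ j → j ≢ k → i ≢ k → χ ((v ◂ f) i) ((v ◂ f) j) ((v ◂ f) k) ≡ true
    red′ zero zero k a b c = ⊥-elim (a refl)
    red′ zero (suc j) zero a b c = ⊥-elim (c refl)
    red′ zero (suc j) (suc k) a b c = h j k (b ∘ cong suc)
    red′ (suc i) zero zero a b c = ⊥-elim (b refl)
    red′ (suc i) zero (suc k) a b c = swap₁ χ sy (h i k (c ∘ cong suc))
    red′ (suc i) (suc j) zero a b c = rot (h i j (a ∘ cong suc))
    red′ (suc i) (suc j) (suc k) a b c = red i j k (a ∘ cong suc) (b ∘ cong suc) (c ∘ cong suc)

  redClique-4 : ∀ p q r t → p ≢ q → p ≢ r → p ≢ t → q ≢ r → q ≢ t → r ≢ t →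
    χ p q r ≡ true → χ p q t ≡ true → χ p r t ≡ true → χ q r t ≡ true → RedClique χ 4
  redClique-4 p q r t pq pr pt qr qt rt pqr pqt prt qrt =
    redClique-cons {3} p (redClique-cons {2} q (redClique-cons {1} r (redClique-cons {0} t
        ((λ ()) , (λ { {()} }) , λ ()) (λ ()) (λ ()))
      (λ { zero → rt ∘ sym })
      (λ { zero zero ne → ⊥-elim (ne refl) }))
      (λ { zero → qr ∘ sym ; (suc zero) → qt ∘ sym })
      (λ { zero zero ne → ⊥-elim (ne refl) ; zero (suc zero) _ → qrt
         ; (suc zero) zero _ → swap₂ χ sy qrt ; (suc zero) (suc zero) ne → ⊥-elim (ne refl) }))
      (λ { zero → pq ∘ sym ; (suc zero) → pr ∘ sym ; (suc (suc zero)) → pt ∘ sym })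
      (λ { zero zero ne → ⊥-elim (ne refl) ; zero (suc zero) _ → pqr ; zero (suc (suc zero)) _ → pqt
         ; (suc zero) zero _ → swap₂ χ sy pqr ; (suc zero) (suc zero) ne → ⊥-elim (ne refl)
         ; (suc zero) (suc (suc zero)) _ → prt
         ; (suc (suc zero)) zero _ → swap₂ χ sy pqt ; (suc (suc zero)) (suc zero) _ → swap₂ χ sy prt
         ; (suc (suc zero)) (suc (suc zero)) ne → ⊥-elim (ne refl) })

  Pool : ℕ → ℕ → Set
  Pool σ M = Σ (Fin σ → Fin N) λ a → Σ (Fin M → Fin N) λ W → Inj a × Inj W × (∀ i w → a i ≢ W w) ×
    (∀ i j → i ≢ j → ∀ w → χ (a i) (a j) (W w) ≡ true)

  -- In the link of each `B b`, Ramsey's theorem on the `n ^ σ` vertices of `A` gives a blue star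
  -- centred at `B b` or a red clique of size `σ`. If no star appears, `M` of the vertices of `B`
  -- share the same clique, as there are at most `K₁ ^ σ` of them.
  find-pool : ∀ σ n M K₁ K₂ → (A : Fin K₁ → Fin N) (B : Fin K₂ → Fin N) → Inj A → Inj B →
    (∀ i j → A i ≢ B j) → 1 ≤ n → 1 ≤ M → K₁ ≡ n ^ σ → K₁ ^ σ * M ≤ K₂ → Pool σ M ⊎ BlueStar χ n
  find-pool σ n M K₁ K₂ A B A-inj B-inj A≢B 1≤n 1≤M refl le = finish (distribute cliques)
    where
    link : Fin K₂ → Graph K₁
    link b x y = χ (B b) (A x) (A y)
    cliques : ∀ b → Homogeneous (link b) true σ ⊎ BlueStar χ n
    cliques b = map₂ (λ { (f , inj , hom) → B b , A ∘ f , (inj ∘ A-inj) , (λ i → A≢B _ _) , hom })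
      (graph-ramsey σ n (link b) (λ _ _ → proj₂ (sy _ _ _)) ≤-refl)
    finish : (∀ b → Homogeneous (link b) true σ) ⊎ BlueStar χ n → Pool σ M ⊎ BlueStar χ n
    finish (inj₂ s) = inj₂ s
    finish (inj₁ H) = select-class (pigeonhole M (m^n>0 K₁ ⦃ m^n≢0 n σ ⦃ >-nonZero 1≤n ⦄ ⦄ σ) code le)
      where
      code : Fin K₂ → Fin (K₁ ^ σ)
      code b = funToFin (proj₁ (H b))
      select-class : Fibre code M → Pool σ M ⊎ BlueStar χ n
      select-class (e , ρ , ρ-inj , same) = inj₁ (A ∘ f , B ∘ ρ , (f-inj ∘ A-inj) , (ρ-inj ∘ B-inj) ,
          (λ i w → A≢B _ _) , λ i j ne w → red i j ne w)
        where
        f : Fin σ → Fin K₁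
        f = finToFun e
        agree : ∀ w i → proj₁ (H (ρ w)) i ≡ f i
        agree w i = trans (sym (Finₚ.finToFun-funToFin (proj₁ (H (ρ w))) i))
                          (cong (λ z → finToFun z i) (same w))
        -- The decoded clique inherits injectivity from any member of the fibre; `1 ≤ M` supplies
        -- one.
        f-inj : Inj f
        f-inj = Inj-ext (agree (Fin.fromℕ< 1≤M)) (proj₁ (proj₂ (H (ρ (Fin.fromℕ< 1≤M)))))
        red : ∀ i j → i ≢ j → ∀ w → χ (A (f i)) (A (f j)) (B (ρ w)) ≡ true
        red i j ne w = rot (trans (cong₂ (λ x y → χ (B (ρ w)) (A x) (A y)) (sym (agree w i)) (sym (agree w j)))
                              (proj₂ (proj₂ (H (ρ w))) i j ne))

  count-exclusive : ∀ {k} (b : Fin k → Bool) →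
    (∀ i j → i ≢ j → b i ≡ true → b j ≡ true → ⊥) → count b ≤ 1
  count-exclusive b ex with 2 ≤? count b
  ... | no p = ≤-pred (≰⇒> p)
  ... | yes p = let ι , inj , ok = select b p in
    ⊥-elim (ex (ι zero) (ι (suc zero)) (λ e → Finₚ.0≢1+n (inj e)) (ok zero) (ok (suc zero)))

  module _ (σ M n c : ℕ) (2≤σ : 2 ≤ σ) (σ≤M : σ ≤ M) (1≤n : 1 ≤ n) (σc : 16 * n ≤ σ * c)
           (large : 4 * (n ^ c * n ^ suc c) ≤ M) (no-red : ¬ RedClique χ 4) where

    -- The red links of the clique vertices are pairwise disjoint, so one of them is sparse.
    pool⇒star : Pool σ M → BlueStar χ n
    pool⇒star (a , W , a-inj , W-inj , a≢W , red) = finish (∃-below-average density total)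
      where
      -- The red link of `a i` on the pool, with the loops that the Erdős-Szemerédi argument asks
      -- for.
      G : Fin σ → Graph M
      G i x y = χ (a i) (W x) (W y) ∨ (x ≡ᵇᶠ y)

      density : Fin σ → ℕ
      density i = σ * sum (λ x → count (G i x))

      disjoint : ∀ {x y} → x ≢ y → ∀ i j → i ≢ j → G i x y ≡ true → G j x y ≡ true → ⊥
      disjoint {x} {y} ne i j ne′ p q rewrite ≢⇒≡ᵇᶠ-false ne
        | Boolₚ.∨-identityʳ (χ (a i) (W x) (W y)) | Boolₚ.∨-identityʳ (χ (a j) (W x) (W y)) =
        no-red (redClique-4 (a i) (a j) (W x) (W y) (ne′ ∘ a-inj) (a≢W _ _) (a≢W _ _) (a≢W _ _) (a≢W _ _)
          (ne ∘ W-inj) (red i j ne′ x) (red i j ne′ y) p q)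

      -- Off the diagonal a pair lies in at most one red link; on the diagonal the loops put it in
      -- all `σ` graphs. The loops cost `σ * M ≤ M * M` in total.
      pointwise : ∀ x y → count (λ i → G i x y) ≤ 1 + σ * 𝟙 (x ≡ᵇᶠ y)
      pointwise x y with x Fin.≟ y in eq
      ... | yes refl = ≤-trans (sum-≤ {σ} {1} (λ i → 𝟙≤1 (χ (a i) (W x) (W x) ∨ true))) (n≤1+n _)
        where
        𝟙≤1 : ∀ b → 𝟙 b ≤ 1
        𝟙≤1 true = ≤-refl
        𝟙≤1 false = z≤n
      ... | no ne = ≤-trans (count-exclusive _ excl) (m≤m+n 1 _)
        where
        excl : ∀ i j → i ≢ j → χ (a i) (W x) (W y) ∨ false ≡ true → χ (a j) (W x) (W y) ∨ false ≡ true → ⊥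
        excl i j ne′ p q = disjoint ne i j ne′ (trans (cong (χ (a i) (W x) (W y) ∨_) (≢⇒≡ᵇᶠ-false ne)) p)
                                               (trans (cong (χ (a j) (W x) (W y) ∨_) (≢⇒≡ᵇᶠ-false ne)) q)

      edges : sum (λ i → sum (λ x → count (G i x))) ≤ 2 * (M * M)
      edges = begin
        sum (λ i → sum (λ x → count (G i x)))
          ≡⟨ ∑-comm +-*-semiring (λ i x → count (G i x)) ⟩
        sum (λ x → sum (λ i → count (G i x)))
          ≡⟨ sum-cong-≗ +-*-semiring (λ x → ∑-comm +-*-semiring (λ i y → 𝟙 (G i x y))) ⟩
        sum (λ x → sum (λ y → count (λ i → G i x y)))
          ≤⟨ sum-≤ row ⟩
        M * (M + σ)
          ≤⟨ *-monoʳ-≤ M (+-monoʳ-≤ M σ≤M) ⟩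
        M * (M + M)
          ≡⟨ arith M ⟩
        2 * (M * M) ∎
        where
        open ≤-Reasoning
        arith : ∀ x → x * (x + x) ≡ 2 * (x * x)
        arith = solve-∀
        row : ∀ x → sum (λ y → count (λ i → G i x y)) ≤ M + σ
        row x = begin
          sum (λ y → count (λ i → G i x y)) ≤⟨ sum-mono (pointwise x) ⟩
          sum (λ y → 1 + σ * 𝟙 (x ≡ᵇᶠ y))
            ≡⟨ ∑-distrib-+ +-*-semiring (λ _ → 1) (λ y → σ * 𝟙 (x ≡ᵇᶠ y)) ⟩
          sum {M} (λ _ → 1) + sum (λ y → σ * 𝟙 (x ≡ᵇᶠ y))
            ≡⟨ cong₂ _+_ (trans (sum-const M 1) (*-identityʳ M))
                 (trans (sym (*-distribˡ-sum σ (λ y → 𝟙 (x ≡ᵇᶠ y))))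
                   (trans (cong (σ *_) (count-≡ x)) (*-identityʳ σ))) ⟩
          M + σ ∎

      -- The successor only provides the strict inequality that averaging needs; it is removed again
      -- by `≤-pred`.
      total : sum density < σ * suc (2 * (M * M))
      total = begin-strict
        sum density ≡⟨ *-distribˡ-sum σ (λ i → sum (λ x → count (G i x))) ⟨
        σ * sum (λ i → sum (λ x → count (G i x))) ≤⟨ *-monoʳ-≤ σ edges ⟩
        σ * (2 * (M * M)) <⟨ *-monoʳ-< σ ⦃ >-nonZero (≤-trans (s≤s z≤n) 2≤σ) ⦄ (n<1+n _) ⟩
        σ * suc (2 * (M * M)) ∎
        where open ≤-Reasoning

      G-sym : ∀ i x y → G i x y ≡ G i y x
      G-sym i x y = cong₂ _∨_ (proj₂ (sy _ _ _)) (≡ᵇᶠ-sym x y)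
        where
        ≡ᵇᶠ-sym : ∀ (x y : Fin M) → (x ≡ᵇᶠ y) ≡ (y ≡ᵇᶠ x)
        ≡ᵇᶠ-sym x y with x Fin.≟ y | y Fin.≟ x
        ... | yes _ | yes _ = refl
        ... | no _ | no _ = refl
        ... | yes p | no q = ⊥-elim (q (sym p))
        ... | no p | yes q = ⊥-elim (p (sym q))

      G-loop : ∀ i x → G i x x ≡ true
      G-loop i x = trans (cong (χ (a i) (W x) (W x) ∨_) (≡ᵇᶠ-refl x)) (Boolₚ.∨-zeroʳ _)

      G-false : ∀ i x y → G i x y ≡ false → χ (a i) (W x) (W y) ≡ false
      G-false i x y e with χ (a i) (W x) (W y)
      ... | false = refl

      star-at : ∀ i → Homogeneous (G i) false n → BlueStar χ n
      star-at i (f , inj , hom) = a i , W ∘ f , (inj ∘ W-inj) , (λ t e → a≢W i (f t) (sym e)) ,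
        λ s t ne → G-false i _ _ (hom s t ne)

      disjoint-false : ∀ i j → i ≢ j → ∀ x y → x ≢ y → G i x y ≡ true → G j x y ≡ false
      disjoint-false i j ne x y ne′ p = Boolₚ.¬-not λ q → disjoint ne′ i j ne p q

      star-beside : ∀ i → Homogeneous (G i) true n → BlueStar χ n
      star-beside i (f , inj , hom) = let j , ne = another 2≤σ i in
        star-at j (f , inj , λ s t ne′ → disjoint-false i j ne (f s) (f t) (ne′ ∘ inj) (hom s t ne′))

      finish : (∃ λ i → density i < suc (2 * (M * M))) → BlueStar χ n
      finish (i , d) = [ star-beside i , star-at i ]′
        (sparse-homogeneous (G i) (G-sym i) (G-loop i) σ c n 1≤n σc (≤-pred d) large)

-- The vertex set is cut into a part of size `n ^ σ`, where the clique is sought, and a part from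
-- which the pool is drawn. As being good is decidable, the absence of a red K₄ may be assumed.
arrows-4 : ∀ σ n c → 2 ≤ σ → 1 ≤ n → 16 * n ≤ σ * c → σ ≤ 4 * (n ^ c * n ^ suc c) →
  Arrows (n ^ σ + (n ^ σ) ^ σ * (4 * (n ^ c * n ^ suc c))) 4 n
arrows-4 σ n c 2≤σ 1≤n σc σ≤M χ sy = decidable-stable (good? χ 4 n) λ bad →
  bad (inj₂ (conclude (bad ∘ inj₁)))
  where
  K = n ^ σ
  M = 4 * (n ^ c * n ^ suc c)
  conclude : ¬ RedClique χ 4 → BlueStar χ n
  conclude no-red = [ pool⇒star χ sy σ M n c 2≤σ σ≤M 1≤n σc ≤-refl no-red , id ]′
    (find-pool χ sy σ n M K (K ^ σ * M) (Fin._↑ˡ (K ^ σ * M)) (K Fin.↑ʳ_)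
      (λ {i} {j} → Finₚ.↑ˡ-injective _ i j) (λ {i} {j} → Finₚ.↑ʳ-injective K i j) ↑ˡ≢↑ʳ
      1≤n (≤-trans (≤-trans (s≤s z≤n) 2≤σ) σ≤M) refl ≤-refl)

-- Logarithms, integer square roots and the choice of parameters

n≤2^⌈log₂n⌉ : ∀ n → n ≤ 2 ^ ⌈log₂ n ⌉
n≤2^⌈log₂n⌉ n = go n (<-wellFounded n)
  where
  -- The induction follows the accessibility proof on which `⌈log2⌉` itself recurses.
  go : ∀ n (a : Acc _<_ n) → n ≤ 2 ^ ⌈log2⌉ n a
  go 0 _ = z≤n
  go 1 _ = ≤-refl
  go (suc (suc n)) (acc rs) = begin
    2 + n                     ≡⟨ cong (2 +_) (⌊n/2⌋+⌈n/2⌉≡n n) ⟨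
    2 + (⌊ n /2⌋ + ⌈ n /2⌉)   ≤⟨ +-monoʳ-≤ 2 (+-monoˡ-≤ ⌈ n /2⌉ (⌊n/2⌋≤⌈n/2⌉ n)) ⟩
    2 + (⌈ n /2⌉ + ⌈ n /2⌉)   ≡⟨ arith ⌈ n /2⌉ ⟩
    2 * suc ⌈ n /2⌉           ≤⟨ *-monoʳ-≤ 2 (go (suc ⌈ n /2⌉) _) ⟩
    2 * 2 ^ ⌈log2⌉ (suc ⌈ n /2⌉) _ ∎
    where
    open ≤-Reasoning
    arith : ∀ x → 2 + (x + x) ≡ 2 * suc x
    arith = solve-∀

2^⌊log₂n⌋≤n : ∀ n → 1 ≤ n → 2 ^ ⌊log₂ n ⌋ ≤ n
2^⌊log₂n⌋≤n n = go n (<-wellFounded n)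
  where
  go : ∀ n (a : Acc _<_ n) → 1 ≤ n → 2 ^ ⌊log2⌋ n a ≤ n
  go 1 _ _ = ≤-refl
  go (suc (suc n)) (acc rs) _ = begin
    2 * 2 ^ ⌊log2⌋ (suc ⌊ n /2⌋) _ ≤⟨ *-monoʳ-≤ 2 (go (suc ⌊ n /2⌋) _ (s≤s z≤n)) ⟩
    2 * suc ⌊ n /2⌋           ≡⟨ arith ⌊ n /2⌋ ⟨
    2 + (⌊ n /2⌋ + ⌊ n /2⌋)   ≤⟨ +-monoʳ-≤ 2 (+-monoʳ-≤ ⌊ n /2⌋ (⌊n/2⌋≤⌈n/2⌉ n)) ⟩
    2 + (⌊ n /2⌋ + ⌈ n /2⌉)   ≡⟨ cong (2 +_) (⌊n/2⌋+⌈n/2⌉≡n n) ⟩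
    2 + n ∎
    where
    open ≤-Reasoning
    arith : ∀ x → 2 + (x + x) ≡ 2 * suc x
    arith = solve-∀

n<2^n : ∀ n → n < 2 ^ n
n<2^n zero = s≤s z≤n
n<2^n (suc n) = begin-strict
  suc n         ≡⟨⟩
  1 + n         <⟨ +-mono-≤-< (m^n>0 2 n) (n<2^n n) ⟩
  2 ^ n + 2 ^ n ≡⟨ cong (2 ^ n +_) (+-identityʳ (2 ^ n)) ⟨
  2 ^ suc n     ∎
  where open ≤-Reasoning

square-root : ∀ m → ∃ λ k → k * k ≤ m × m < suc k * suc k
square-root zero = 0 , z≤n , s≤s z≤n
square-root (suc m) with square-root m
... | k , lo , hi with suc m <? suc k * suc k
...   | yes lt = k , m≤n⇒m≤1+n lo , lt
...   | no ge = suc k , ≮⇒≥ ge , ≤-<-trans hi (*-mono-< (n<1+n (suc k)) (n<1+n (suc k)))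

square-cancel-≤ : ∀ {a b} → a * a ≤ b * b → a ≤ b
square-cancel-≤ {a} {b} le with a ≤? b
... | yes p = p
... | no p = ⊥-elim (<-irrefl refl (<-≤-trans (*-mono-< (≰⇒> p) (≰⇒> p)) le))

-- Here `m` is any integer at least n^(2/3). With `σ` one more than the integer square root of `m`,
-- both `σ * σ ≤ 4 * m` and `n ≤ m * σ` hold, the latter because n² ≤ m³ ≤ m²σ². Hence `c = 16 * m`
-- satisfies `16 * n ≤ σ * c`, and all exponents are of order `m`.
arrows-4-subexponential : ∀ n m → 2 ≤ n → n * n ≤ m * m * m → Arrows (2 ^ (40 * m * ⌈log₂ n ⌉)) 4 n
arrows-4-subexponential n m 2≤n nn≤mmm = result (square-root m)
  where
  open ≤-Reasoning
  instance
    n≢0 : NonZero n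
    n≢0 = >-nonZero (≤-trans (s≤s z≤n) 2≤n)
  1≤n : 1 ≤ n
  1≤n = ≤-trans (s≤s z≤n) 2≤n
  1≤m : 1 ≤ m
  1≤m = n≢0⇒n>0 λ m≡0 → <-irrefl refl (≤-trans (*-mono-≤ 1≤n 1≤n)
    (subst (λ z → n * n ≤ z * z * z) m≡0 nn≤mmm))
  c = 16 * m

  result : (∃ λ k → k * k ≤ m × m < suc k * suc k) → Arrows (2 ^ (40 * m * ⌈log₂ n ⌉)) 4 n
  result (zero , lo , hi) = ⊥-elim (<-irrefl refl (≤-trans hi 1≤m))
  result (suc k , lo , hi) = arrows-mono bound (arrows-4 σ n c (s≤s (s≤s z≤n)) 1≤n σc σ≤M)
    where
    σ = suc (suc k)
    σσ≤4m : σ * σ ≤ 4 * m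
    σσ≤4m = begin
      σ * σ                     ≤⟨ *-mono-≤ σ≤2k σ≤2k ⟩
      (2 * suc k) * (2 * suc k) ≡⟨ arith (suc k) ⟩
      4 * (suc k * suc k)       ≤⟨ *-monoʳ-≤ 4 lo ⟩
      4 * m                     ∎
      where
      arith : ∀ x → (2 * x) * (2 * x) ≡ 4 * (x * x)
      arith = solve-∀
      σ≤2k : σ ≤ 2 * suc k
      σ≤2k = s≤s (≤-trans (s≤s (m≤m+n k _)) (≤-reflexive (sym (+-suc k _))))
    σ≤4m : σ ≤ 4 * m
    σ≤4m = ≤-trans (m≤m*n σ σ) σσ≤4m
    n≤mσ : n ≤ m * σ
    n≤mσ = square-cancel-≤ (begin
      n * n             ≤⟨ nn≤mmm ⟩
      m * m * m         ≤⟨ *-monoʳ-≤ (m * m) (<⇒≤ hi) ⟩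
      m * m * (σ * σ)   ≡⟨ arith m σ ⟩
      m * σ * (m * σ)   ∎)
      where
      arith : ∀ x y → x * x * (y * y) ≡ x * y * (x * y)
      arith = solve-∀
    σc : 16 * n ≤ σ * c
    σc = begin
      16 * n       ≤⟨ *-monoʳ-≤ 16 n≤mσ ⟩
      16 * (m * σ) ≡⟨ arith m σ ⟩
      σ * (16 * m) ∎
      where
      arith : ∀ x y → 16 * (x * y) ≡ y * (16 * x)
      arith = solve-∀
    σ≤M : σ ≤ 4 * (n ^ c * n ^ suc c)
    σ≤M = begin
      σ                       ≤⟨ σ≤4m ⟩
      4 * m                   ≤⟨ *-monoʳ-≤ 4 (<⇒≤ (n<2^n m)) ⟩
      4 * 2 ^ m               ≤⟨ *-monoʳ-≤ 4 (^-monoˡ-≤ m 2≤n) ⟩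
      4 * n ^ m               ≤⟨ *-monoʳ-≤ 4 (^-monoʳ-≤ n (m≤n*m m 16)) ⟩
      4 * n ^ c               ≤⟨ *-monoʳ-≤ 4 (m≤m*n (n ^ c) (n ^ suc c) ⦃ m^n≢0 n (suc c) ⦄) ⟩
      4 * (n ^ c * n ^ suc c) ∎
    pow : ∀ {a b} → a ≤ b → n ^ a ≤ n ^ b
    pow = ^-monoʳ-≤ n
    -- The exponents add up from `σ * σ ≤ 4 * m`, from `4 ≤ n ^ 2`, and from
    -- `c + suc c = 32 * m + 1`.
    E = 36 * m + 3
    term₁ : n ^ σ ≤ n ^ E
    term₁ = pow (≤-trans σ≤4m (≤-trans (*-monoˡ-≤ m {4} {36} (m≤m+n 4 32)) (m≤m+n (36 * m) 3)))
    term₂ : (n ^ σ) ^ σ * (4 * (n ^ c * n ^ suc c)) ≤ n ^ E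
    term₂ = begin
      (n ^ σ) ^ σ * (4 * (n ^ c * n ^ suc c))
        ≡⟨ cong (_* (4 * (n ^ c * n ^ suc c))) (^-*-assoc n σ σ) ⟩
      n ^ (σ * σ) * (4 * (n ^ c * n ^ suc c))
        ≤⟨ *-mono-≤ (pow σσ≤4m) (*-monoˡ-≤ (n ^ c * n ^ suc c) (^-monoˡ-≤ 2 2≤n)) ⟩
      n ^ (4 * m) * (n ^ 2 * (n ^ c * n ^ suc c))
        ≡⟨ cong (λ z → n ^ (4 * m) * (n ^ 2 * z)) (^-distribˡ-+-* n c (suc c)) ⟨
      n ^ (4 * m) * (n ^ 2 * n ^ (c + suc c))
        ≡⟨ cong (n ^ (4 * m) *_) (^-distribˡ-+-* n 2 (c + suc c)) ⟨
      n ^ (4 * m) * n ^ (2 + (c + suc c))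
        ≡⟨ ^-distribˡ-+-* n (4 * m) (2 + (c + suc c)) ⟨
      n ^ (4 * m + (2 + (c + suc c)))
        ≡⟨ cong (n ^_) (arith m) ⟩
      n ^ E ∎
      where
      arith : ∀ x → 4 * x + (2 + (16 * x + suc (16 * x))) ≡ 36 * x + 3
      arith = solve-∀
    bound : n ^ σ + (n ^ σ) ^ σ * (4 * (n ^ c * n ^ suc c)) ≤ 2 ^ (40 * m * ⌈log₂ n ⌉)
    bound = begin
      n ^ σ + (n ^ σ) ^ σ * (4 * (n ^ c * n ^ suc c)) ≤⟨ +-mono-≤ term₁ term₂ ⟩
      n ^ E + n ^ E        ≡⟨ cong (n ^ E +_) (+-identityʳ (n ^ E)) ⟨
      2 * n ^ E            ≤⟨ *-monoˡ-≤ (n ^ E) 2≤n ⟩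
      n ^ suc E            ≤⟨ pow exponent ⟩
      n ^ (40 * m)         ≤⟨ ^-monoˡ-≤ (40 * m) (n≤2^⌈log₂n⌉ n) ⟩
      (2 ^ ⌈log₂ n ⌉) ^ (40 * m) ≡⟨ ^-*-assoc 2 ⌈log₂ n ⌉ (40 * m) ⟩
      2 ^ (⌈log₂ n ⌉ * (40 * m)) ≡⟨ cong (2 ^_) (*-comm ⌈log₂ n ⌉ (40 * m)) ⟩
      2 ^ (40 * m * ⌈log₂ n ⌉) ∎
      where
      exponent : suc E ≤ 40 * m
      exponent = begin
        suc (36 * m + 3) ≡⟨ arith m ⟩
        36 * m + 4 * 1   ≤⟨ +-monoʳ-≤ (36 * m) (*-monoʳ-≤ 4 1≤m) ⟩
        36 * m + 4 * m   ≡⟨ arith₂ m ⟩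
        40 * m           ∎
        where
        arith : ∀ x → suc (36 * x + 3) ≡ 36 * x + 4 * 1
        arith = solve-∀
        arith₂ : ∀ x → 36 * x + 4 * x ≡ 40 * x
        arith₂ = solve-∀

arrows-2^ : ∀ s n → 1 ≤ s → 1 ≤ n → Arrows (2 ^ (2 * s * s * n)) s n
arrows-2^ s n 1≤s 1≤n = arrows-mono (begin
    suc s ^ (s * suc n)   ≤⟨ ^-monoˡ-≤ (s * suc n) (n<2^n s) ⟩
    (2 ^ s) ^ (s * suc n) ≡⟨ ^-*-assoc 2 s (s * suc n) ⟩
    2 ^ (s * (s * suc n)) ≤⟨ ^-monoʳ-≤ 2 (*-monoʳ-≤ s (*-monoʳ-≤ s (+-monoˡ-≤ n 1≤n))) ⟩
    2 ^ (s * (s * (n + n))) ≡⟨ cong (2 ^_) (arith s n) ⟩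
    2 ^ (2 * s * s * n) ∎) (arrows-exponential s n 1≤s 1≤n)
  where
  open ≤-Reasoning
  arith : ∀ x y → x * (x * (y + y)) ≡ 2 * x * x * y
  arith = solve-∀

-- Random labellings of pairs

product : ∀ {n} → (Fin n → ℕ) → ℕ
product = foldr _*_ 1

term≤sum : ∀ {n} (f : Fin n → ℕ) i → f i ≤ sum f
term≤sum f zero = m≤m+n _ _
term≤sum f (suc i) = ≤-trans (term≤sum (f ∘ suc) i) (m≤n+m _ (f zero))

-- The method of conditional expectations: the left side of the hypothesis counts, with
-- multiplicity, the assignments lying in some event of positive weight.
avoid-events : ∀ M {K T} (S : Fin T → Fin M → Fin K → Bool) (α : Fin T → ℕ) →
  sum (λ t → α t * product (λ i → count (S t i))) < K ^ M →
  Σ (Fin M → Fin K) λ x → ∀ t → α t ≡ 0 ⊎ ∃ λ i → S t i (x i) ≡ false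
avoid-events zero S α lt = (λ ()) , λ t → inj₁ (n≤0⇒n≡0 (≤-trans (≤-reflexive (sym (*-identityʳ (α t))))
  (≤-trans (term≤sum (λ t → α t * 1) t) (≤-pred lt))))
avoid-events (suc M) {K} {T} S α lt = finish (∃-below-average w (subst (_< K * K ^ M) (sym total) lt))
  where
  rest : Fin T → ℕ
  rest t = product (λ i → count (S t (suc i)))
  -- The same weighted count with the first coordinate fixed to `j`. Over all `j` these add up to
  -- the whole, so some choice keeps the count below `K ^ M`.
  w : Fin K → ℕ
  w j = sum (λ t → α t * 𝟙 (S t zero j) * rest t)
  total : sum w ≡ sum (λ t → α t * product (λ i → count (S t i)))
  total = trans (∑-comm +-*-semiring (λ j t → α t * 𝟙 (S t zero j) * rest t))
    (sum-cong-≗ +-*-semiring row)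
    where
    row : ∀ t → sum (λ j → α t * 𝟙 (S t zero j) * rest t) ≡ α t * product (λ i → count (S t i))
    row t = begin
      sum (λ j → α t * 𝟙 (S t zero j) * rest t)
        ≡⟨ *-distribʳ-sum (rest t) (λ j → α t * 𝟙 (S t zero j)) ⟨
      sum (λ j → α t * 𝟙 (S t zero j)) * rest t
        ≡⟨ cong (_* rest t) (*-distribˡ-sum (α t) (λ j → 𝟙 (S t zero j))) ⟨
      α t * count (S t zero) * rest t
        ≡⟨ *-assoc (α t) (count (S t zero)) (rest t) ⟩
      α t * (count (S t zero) * rest t) ∎
      where open ≡-Reasoning
  finish : (∃ λ j → w j < K ^ M) → Σ (Fin (suc M) → Fin K) λ x → ∀ t → α t ≡ 0 ⊎ ∃ λ i → S t i (x i) ≡ false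
  finish (j , lt′) = extend (avoid-events M (λ t i → S t (suc i)) (λ t → α t * 𝟙 (S t zero j)) lt′)
    where
    extend : (Σ (Fin M → Fin K) λ x → ∀ t → α t * 𝟙 (S t zero j) ≡ 0 ⊎ ∃ λ i → S t (suc i) (x i) ≡ false) →
      Σ (Fin (suc M) → Fin K) λ x → ∀ t → α t ≡ 0 ⊎ ∃ λ i → S t i (x i) ≡ false
    extend (x , ok) = x′ , ok′
      where
      x′ : Fin (suc M) → Fin K
      x′ zero = j
      x′ (suc i) = x i
      ok′ : ∀ t → α t ≡ 0 ⊎ ∃ λ i → S t i (x′ i) ≡ false
      ok′ t with ok t
      ... | inj₂ (i , e) = inj₂ (suc i , e)
      ... | inj₁ e with m*n≡0⇒m≡0∨n≡0 (α t) e
      ...   | inj₁ z = inj₁ z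
      ...   | inj₂ z = inj₂ (zero , 𝟙≡0 (S t zero j) z)
        where
        𝟙≡0 : ∀ b → 𝟙 b ≡ 0 → b ≡ false
        𝟙≡0 false _ = refl

-- Without denominators: if the coordinates in `p` each allow at most `y` of `K` values, the
-- probability of the event is at most (y/K)^(count p).
product-hits : ∀ {M K y} (p : Fin M → Bool) (f : Fin M → ℕ) →
  (∀ i → p i ≡ true → f i ≤ y) → (∀ i → f i ≤ K) →
  product f * K ^ count p ≤ y ^ count p * K ^ M
product-hits {zero} p f hit all = ≤-refl
product-hits {suc M} {K} {y} p f hit all with p zero in eq
... | true = begin
    f zero * P * (K * K ^ c)    ≡⟨ a₁ (f zero) P K (K ^ c) ⟩
    f zero * (K * (P * K ^ c))  ≤⟨ *-mono-≤ (hit zero eq) (*-monoʳ-≤ K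
          (product-hits (p ∘ suc) (f ∘ suc) (hit ∘ suc) (all ∘ suc))) ⟩
    y * (K * (y ^ c * K ^ M))   ≡⟨ a₂ y K (y ^ c) (K ^ M) ⟩
    y * y ^ c * (K * K ^ M)     ∎
  where
  open ≤-Reasoning
  P = product (f ∘ suc)
  c = count (p ∘ suc)
  a₁ : ∀ a b d e → a * b * (d * e) ≡ a * (d * (b * e))
  a₁ = solve-∀
  a₂ : ∀ a b d e → a * (b * (d * e)) ≡ a * d * (b * e)
  a₂ = solve-∀
... | false = begin
    f zero * P * K ^ c          ≡⟨ *-assoc (f zero) P (K ^ c) ⟩
    f zero * (P * K ^ c)        ≤⟨ *-mono-≤ (all zero) (product-hits (p ∘ suc) (f ∘ suc) (hit ∘ suc) (all ∘ suc)) ⟩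
    K * (y ^ c * K ^ M)         ≡⟨ a₂ K (y ^ c) (K ^ M) ⟩
    y ^ c * (K * K ^ M)         ∎
  where
  open ≤-Reasoning
  P = product (f ∘ suc)
  c = count (p ∘ suc)
  a₂ : ∀ a b d → a * (b * d) ≡ b * (a * d)
  a₂ = solve-∀

product-bound : ∀ {M K y h} (p : Fin M → Bool) (f : Fin M → ℕ) →
  (∀ i → p i ≡ true → f i ≤ y) → (∀ i → f i ≤ K) → 1 ≤ K → y ≤ K → h ≤ count p →
  product f * K ^ h ≤ y ^ h * K ^ M
product-bound {M} {K} {y} {h} p f hit all 1≤K y≤K h≤ =
  *-cancelʳ-≤ (product f * K ^ h) (y ^ h * K ^ M) (K ^ e) ⦃ m^n≢0 K e ⦃ >-nonZero 1≤K ⦄ ⦄ (begin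
    product f * K ^ h * K ^ e   ≡⟨ *-assoc (product f) (K ^ h) (K ^ e) ⟩
    product f * (K ^ h * K ^ e) ≡⟨ cong (product f *_) (^-distribˡ-+-* K h e) ⟨
    product f * K ^ (h + e)     ≡⟨ cong (λ x → product f * K ^ x) (m+[n∸m]≡n h≤) ⟩
    product f * K ^ count p     ≤⟨ product-hits p f hit all ⟩
    y ^ count p * K ^ M         ≡⟨ cong (λ x → y ^ x * K ^ M) (m+[n∸m]≡n h≤) ⟨
    y ^ (h + e) * K ^ M         ≡⟨ cong (_* K ^ M) (^-distribˡ-+-* y h e) ⟩
    y ^ h * y ^ e * K ^ M       ≤⟨ *-monoˡ-≤ (K ^ M) (*-monoʳ-≤ (y ^ h) (^-monoˡ-≤ e y≤K)) ⟩
    y ^ h * K ^ e * K ^ M       ≡⟨ a₁ (y ^ h) (K ^ e) (K ^ M) ⟩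
    y ^ h * K ^ M * K ^ e       ∎)
  where
  open ≤-Reasoning
  e = count p ∸ h
  a₁ : ∀ a b d → a * b * d ≡ a * d * b
  a₁ = solve-∀

count-≤ : ∀ {n} (p : Fin n → Bool) → count p ≤ n
count-≤ p = ≤-trans (m≤m+n (count p) _) (≤-reflexive (count-not p))

-- A union bound: a valid event restricts at least `h` coordinates to at most `y` of `K` values, so
-- it has probability at most (y/K)^h, and there are `T` events.
avoid-restrictions : ∀ M {K T} y h (S : Fin T → Fin M → Fin K → Bool) (valid : Fin T → Bool)
  (hit : Fin T → Fin M → Bool) → (∀ t i → hit t i ≡ true → count (S t i) ≤ y) →
  (∀ t → valid t ≡ true → h ≤ count (hit t)) → 1 ≤ K → y ≤ K → T * y ^ h < K ^ h →
  Σ (Fin M → Fin K) λ x → ∀ t → valid t ≡ true → ∃ λ i → S t i (x i) ≡ false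
avoid-restrictions M {K} {T} y h S valid hit small many 1≤K y≤K lt =
  let x , ok = avoid-events M S (𝟙 ∘ valid) total in x , λ t v → conclude (ok t) v
  where
  open ≤-Reasoning
  conclude : ∀ {b} {A : Set} → 𝟙 b ≡ 0 ⊎ A → b ≡ true → A
  conclude (inj₂ a) _ = a
  conclude (inj₁ ()) refl
  P : Fin T → ℕ
  P t = product (λ i → count (S t i))
  term : ∀ t → 𝟙 (valid t) * P t * K ^ h ≤ y ^ h * K ^ M
  term t with valid t in eq
  ... | false = z≤n
  ... | true = ≤-trans (≤-reflexive (cong (_* K ^ h) (*-identityˡ (P t))))
    (product-bound (hit t) (λ i → count (S t i)) (small t) (λ i → count-≤ (S t i)) 1≤K y≤K (many t eq))
  total : sum (λ t → 𝟙 (valid t) * P t) < K ^ M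
  total = *-cancelʳ-< (K ^ h) (sum (λ t → 𝟙 (valid t) * P t)) (K ^ M) (begin-strict
    sum (λ t → 𝟙 (valid t) * P t) * K ^ h   ≡⟨ *-distribʳ-sum (K ^ h) (λ t → 𝟙 (valid t) * P t) ⟩
    sum (λ t → 𝟙 (valid t) * P t * K ^ h)   ≤⟨ sum-≤ term ⟩
    T * (y ^ h * K ^ M)                     ≡⟨ *-assoc T (y ^ h) (K ^ M) ⟨
    T * y ^ h * K ^ M                       <⟨ *-monoˡ-< (K ^ M) ⦃ m^n≢0 K M ⦃ >-nonZero 1≤K ⦄ ⦄ lt ⟩
    K ^ h * K ^ M                           ≡⟨ *-comm (K ^ h) (K ^ M) ⟩
    K ^ M * K ^ h                           ∎)

-- A pair in either order reads a single one of the `N * N` coordinates, so the labels of distinct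
-- pairs remain independent.
unordered : ∀ {N} {A : Set} → (Fin N → Fin N → A) → Fin N → Fin N → A
unordered g x y with x Fin.<? y
... | yes _ = g x y
... | no _ = g y x

unordered-comm : ∀ {N} {A : Set} (g : Fin N → Fin N → A) x y → unordered g x y ≡ unordered g y x
unordered-comm g x y with x Fin.<? y | y Fin.<? x
... | yes _ | no _ = refl
... | no _ | yes _ = refl
... | yes p | yes q = ⊥-elim (Finₚ.<-asym p q)
... | no p | no q with Finₚ.<-cmp x y
...   | tri< r _ _ = ⊥-elim (p r)
...   | tri> _ _ r = ⊥-elim (q r)
...   | tri≈ _ refl _ = refl

unordered-elim : ∀ {N} {A : Set} (P : Fin N → Fin N → A → Set) (g : Fin N → Fin N → A) →
  (∀ {x y a} → P x y a → P y x a) → (∀ x y → P x y (g x y)) → ∀ x y → P x y (unordered g x y)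
unordered-elim P g sw h x y with x Fin.<? y
... | yes _ = h x y
... | no _ = sw (h y x)

unordered-natural : ∀ {N} {A B : Set} (f : A → B) (g : Fin N → Fin N → A) x y →
  f (unordered g x y) ≡ unordered (λ a b → f (g a b)) x y
unordered-natural f g x y with x Fin.<? y
... | yes _ = refl
... | no _ = refl

unordered-symmetric : ∀ {N} {A : Set} (g : Fin N → Fin N → A) → (∀ x y → g x y ≡ g y x) →
  ∀ x y → unordered g x y ≡ g x y
unordered-symmetric g sy = unordered-elim (λ x y a → a ≡ g x y) g (λ e → trans e (sy _ _)) (λ _ _ → refl)

unordered-combine-injective : ∀ {N} (a b c d : Fin N) →
  unordered combine a b ≡ unordered combine c d → (a ≡ c × b ≡ d) ⊎ (a ≡ d × b ≡ c)
unordered-combine-injective a b c d e with a Fin.<? b | c Fin.<? d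
... | yes _ | yes _ = inj₁ (Finₚ.combine-injective a b c d e)
... | yes _ | no _ = inj₂ (Finₚ.combine-injective a b d c e)
... | no _ | yes _ = let p , q = Finₚ.combine-injective b a c d e in inj₂ (q , p)
... | no _ | no _ = let p , q = Finₚ.combine-injective b a d c e in inj₁ (q , p)

-- Bernoulli's inequality (1 + 1/y)^m ≥ 1 + m/y with denominators cleared.
bernoulli : ∀ y m → y ^ m * (y + m) ≤ suc y ^ m * y
bernoulli y zero = ≤-reflexive (cong (_+ 0) (+-identityʳ y))
bernoulli y (suc m) = begin
  y * y ^ m * (y + suc m)              ≤⟨ m≤m+n _ (y ^ m * m) ⟩
  y * y ^ m * (y + suc m) + y ^ m * m  ≡⟨ a₁ y (y ^ m) m ⟩
  suc y * (y ^ m * (y + m))            ≤⟨ *-monoʳ-≤ (suc y) (bernoulli y m) ⟩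
  suc y * (suc y ^ m * y)              ≡⟨ *-assoc (suc y) (suc y ^ m) y ⟨
  suc y * suc y ^ m * y                ∎
  where
  open ≤-Reasoning
  a₁ : ∀ y p m → y * p * (y + suc m) + p * m ≡ suc y * (p * (y + m))
  a₁ = solve-∀

doubling : ∀ y → 1 ≤ y → 2 * y ^ y ≤ suc y ^ y
doubling y 1≤y = *-cancelʳ-≤ (2 * y ^ y) (suc y ^ y) y ⦃ >-nonZero 1≤y ⦄ (begin
  2 * y ^ y * y    ≡⟨ a₁ (y ^ y) y ⟩
  y ^ y * (y + y)  ≤⟨ bernoulli y y ⟩
  suc y ^ y * y    ∎)
  where
  open ≤-Reasoning
  a₁ : ∀ a b → 2 * a * b ≡ a * (b + b)
  a₁ = solve-∀

doubling-power : ∀ y h → 1 ≤ y → 2 ^ h * y ^ (y * h) ≤ suc y ^ (y * h)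
doubling-power y h 1≤y = begin
  2 ^ h * y ^ (y * h)    ≡⟨ cong (2 ^ h *_) (^-*-assoc y y h) ⟨
  2 ^ h * (y ^ y) ^ h    ≡⟨ ^-distribʳ-* h 2 (y ^ y) ⟨
  (2 * y ^ y) ^ h        ≤⟨ ^-monoˡ-≤ h (doubling y 1≤y) ⟩
  (suc y ^ y) ^ h        ≡⟨ ^-*-assoc (suc y) y h ⟩
  suc y ^ (y * h)        ∎
  where
  open ≤-Reasoning
  ^-distribʳ-* : ∀ h a b → (a * b) ^ h ≡ a ^ h * b ^ h
  ^-distribʳ-* zero a b = refl
  ^-distribʳ-* (suc h) a b = trans (cong (a * b *_) (^-distribʳ-* h a b)) (a₁ a b (a ^ h) (b ^ h))
    where
    a₁ : ∀ a b c d → a * b * (c * d) ≡ a * c * (b * d)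
    a₁ = solve-∀

Disjoint : ∀ {N k} → (Fin k → Fin N) → (Fin k → Fin N) → Set
Disjoint f g = Inj f × Inj g × (∀ i j → f i ≢ g j)

disjoint? : ∀ {N k} (f g : Fin k → Fin N) → Dec (Disjoint f g)
disjoint? f g = injective? f ×-dec (injective? g ×-dec
  (Finₚ.all? λ i → Finₚ.all? λ j → ¬? (f i Fin.≟ g j)))

Disjoint-ext : ∀ {N k} {f f′ g g′ : Fin k → Fin N} → f ≗ f′ → g ≗ g′ → Disjoint f g → Disjoint f′ g′
Disjoint-ext e e′ (a , b , c) = Inj-ext e a , Inj-ext e′ b ,
  λ i j p → c i j (trans (e i) (trans p (sym (e′ j))))

-- ζ v c x y is the value which makes the pair {x , y} red for the centre v when both x and y
-- lie in class c of v.
random-pairs : ∀ {N C} K k → 1 ≤ K → (ζ : Fin N → Fin C → Fin N → Fin N → Fin K) →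
  C * (N * (N ^ k * N ^ k)) * pred K ^ (k * k) < K ^ (k * k) →
  Σ (Fin N → Fin N → Fin K) λ z → ∀ v c f g → Disjoint f g →
    ∃₂ λ (i j : Fin k) → unordered z (f i) (g j) ≡ unordered (ζ v c) (f i) (g j)
random-pairs {N} {C} K k 1≤K ζ lt = finish (avoid-restrictions (N * N) (pred K) (k * k) S valid hit
    hit-count hits-many 1≤K pred[n]≤n lt)
  where
  T = C * (N * (N ^ k * N ^ k))

  cls : Fin T → Fin C
  cls t = quotient _ t
  r₁ : Fin T → Fin (N * (N ^ k * N ^ k))
  r₁ t = remainder {C} _ t
  ctr : Fin T → Fin N
  ctr t = quotient _ (r₁ t)
  r₂ : Fin T → Fin (N ^ k * N ^ k)
  r₂ t = remainder {N} _ (r₁ t)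
  lft rgt : Fin T → Fin k → Fin N
  lft t = finToFun (quotient {N ^ k} (N ^ k) (r₂ t))
  rgt t = finToFun (remainder {N ^ k} (N ^ k) (r₂ t))

  encode : ∀ v c f g → ∃ λ t → cls t ≡ c × ctr t ≡ v × lft t ≗ f × rgt t ≗ g
  encode v c f g = combine c e₁ , cong proj₁ q₀ ,
      trans (cong (quotient _) q₁) (cong proj₁ q₂) ,
      (λ i → trans (cong (λ e → finToFun (quotient {N ^ k} (N ^ k) e) i) q₃)
               (trans (cong (λ e → finToFun e i) (cong proj₁ q₄)) (Finₚ.finToFun-funToFin f i))) ,
      (λ i → trans (cong (λ e → finToFun (remainder {N ^ k} (N ^ k) e) i) q₃)
               (trans (cong (λ e → finToFun e i) (cong proj₂ q₄)) (Finₚ.finToFun-funToFin g i)))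
    where
    e₂ : Fin (N ^ k * N ^ k)
    e₂ = combine (funToFin f) (funToFin g)
    e₁ : Fin (N * (N ^ k * N ^ k))
    e₁ = combine v e₂
    q₀ = Finₚ.remQuot-combine c e₁
    q₁ : r₁ (combine c e₁) ≡ e₁
    q₁ = cong proj₂ q₀
    q₂ = Finₚ.remQuot-combine v e₂
    q₃ : r₂ (combine c e₁) ≡ e₂
    q₃ = trans (cong (remainder {N} _) q₁) (cong proj₂ q₂)
    q₄ = Finₚ.remQuot-combine (funToFin f) (funToFin g)

  hits : ∀ t idx → Dec (∃ λ i → ∃ λ j → idx ≡ unordered combine (lft t i) (rgt t j))
  hits t idx = Finₚ.any? λ i → Finₚ.any? λ j → idx Fin.≟ unordered combine (lft t i) (rgt t j)

  hit : Fin T → Fin (N * N) → Bool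
  hit t idx = ⌊ hits t idx ⌋

  target : Fin T → Fin (N * N) → Fin K
  target t idx = ζ (ctr t) (cls t) (quotient {N} N idx) (remainder {N} N idx)

  -- The event to avoid: every pair between the two sets misses its target. A coordinate hit by such
  -- a pair therefore allows all values but one, and the others are unrestricted.
  S : Fin T → Fin (N * N) → Fin K → Bool
  S t idx κ = not (hit t idx ∧ (target t idx ≡ᵇᶠ κ))

  valid : Fin T → Bool
  valid t = ⌊ disjoint? (lft t) (rgt t) ⌋

  hit-count : ∀ t idx → hit t idx ≡ true → count (S t idx) ≤ pred K
  hit-count t idx e = ≤-reflexive (cong pred (begin
    suc (count (S t idx))
      ≡⟨ cong suc (sum-cong-≗ +-*-semiring (λ κ → cong (λ b → 𝟙 (not (b ∧ (target t idx ≡ᵇᶠ κ)))) e)) ⟩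
    1 + count (not ∘ (target t idx ≡ᵇᶠ_))
      ≡⟨ cong (_+ count (not ∘ (target t idx ≡ᵇᶠ_))) (count-≡ (target t idx)) ⟨
    count (target t idx ≡ᵇᶠ_) + count (not ∘ (target t idx ≡ᵇᶠ_))
      ≡⟨ count-not (target t idx ≡ᵇᶠ_) ⟩
    K ∎))
    where open ≡-Reasoning

  hits-many : ∀ t → valid t ≡ true → k * k ≤ count (hit t)
  hits-many t e with true-⌊⌋ (disjoint? (lft t) (rgt t)) e
  ... | f-inj , g-inj , apart = selection⇒≤count (hit t) (ι , ι-inj , λ p →
        ⌊⌋-true (hits t (ι p)) (quotient {k} k p , remainder {k} k p , refl))
    where
    ι : Fin (k * k) → Fin (N * N)
    ι p = unordered combine (lft t (quotient {k} k p)) (rgt t (remainder {k} k p))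
    ι-inj : Inj ι
    ι-inj {p} {q} e′ with unordered-combine-injective _ _ _ _ e′
    ... | inj₁ (a , b) = trans (sym (Finₚ.combine-remQuot {k} k p))
          (trans (cong₂ combine (f-inj a) (g-inj b)) (Finₚ.combine-remQuot {k} k q))
    ... | inj₂ (a , _) = ⊥-elim (apart _ _ a)

  finish : (Σ (Fin (N * N) → Fin K) λ x → ∀ t → valid t ≡ true → ∃ λ idx → S t idx (x idx) ≡ false) →
    Σ (Fin N → Fin N → Fin K) λ z → ∀ v c f g → Disjoint f g →
      ∃₂ λ (i j : Fin k) → unordered z (f i) (g j) ≡ unordered (ζ v c) (f i) (g j)
  finish (x , ok) = (λ a b → x (combine a b)) , found
    where
    z : Fin N → Fin N → Fin K
    z a b = x (combine a b)
    target-pair : ∀ t a b → target t (unordered combine a b) ≡ unordered (ζ (ctr t) (cls t)) a b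
    target-pair t a b with a Fin.<? b
    ... | yes _ = cong (λ r → ζ (ctr t) (cls t) (proj₁ r) (proj₂ r)) (Finₚ.remQuot-combine a b)
    ... | no _ = cong (λ r → ζ (ctr t) (cls t) (proj₁ r) (proj₂ r)) (Finₚ.remQuot-combine b a)
    S-false : ∀ t idx κ → S t idx κ ≡ false → hit t idx ≡ true × target t idx ≡ κ
    S-false t idx κ e with hit t idx | target t idx ≡ᵇᶠ κ in eq
    ... | true | true = refl , ≡ᵇᶠ-sound eq
    search : ∀ t → valid t ≡ true →
      ∃₂ λ i j → unordered z (lft t i) (rgt t j) ≡ unordered (ζ (ctr t) (cls t)) (lft t i) (rgt t j)
    search t e with ok t e
    ... | idx , s with S-false t idx (x idx) s
    ...   | h , q with true-⌊⌋ (hits t idx) h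
    ...     | i , j , refl = i , j , trans (sym (unordered-natural x combine (lft t i) (rgt t j)))
                (trans (sym q) (target-pair t (lft t i) (rgt t j)))
    found : ∀ v c f g → Disjoint f g →
      ∃₂ λ (i j : Fin k) → unordered z (f i) (g j) ≡ unordered (ζ v c) (f i) (g j)
    found v c f g d with encode v c f g
    ... | t , refl , refl , ef , eg with search t (⌊⌋-true (disjoint? (lft t) (rgt t))
             (Disjoint-ext (λ i → sym (ef i)) (λ i → sym (eg i)) d))
    ...   | i , j , p = i , j , subst₂ (λ a b → unordered z a b ≡ unordered (ζ (ctr t) (cls t)) a b) (ef i) (eg j) p

-- Put y = K - 1 and h = 16yℓ². Then k² = yh, so by `doubling-power` all k² pairs miss their targets
-- with probability at most 2^(-h). The number of events is at most 2^(3 + ℓ + 2ℓk), whose exponent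
-- is at most 12yℓ² < h.
random-colouring : ∀ ℓ K C → 1 ≤ ℓ → 2 ≤ K → C ≤ 8 → let N = 2 ^ ℓ; k = pred K * (4 * ℓ) in
  (ζ : Fin N → Fin C → Fin N → Fin N → Fin K) →
  Σ (Fin N → Fin N → Fin K) λ z → ∀ v c f g → Disjoint f g →
    ∃₂ λ (i j : Fin k) → unordered z (f i) (g j) ≡ unordered (ζ v c) (f i) (g j)
random-colouring ℓ (suc y) C 1≤ℓ (s≤s 1≤y) C≤8 ζ = random-pairs (suc y) k (s≤s z≤n) ζ (begin-strict
    C * (N * (N ^ k * N ^ k)) * y ^ (k * k)  <⟨ *-monoˡ-< (y ^ (k * k)) ⦃ m^n≢0 y (k * k) ⦃ >-nonZero 1≤y ⦄ ⦄ events ⟩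
    2 ^ h * y ^ (k * k)                      ≡⟨ cong (λ e → 2 ^ h * y ^ e) kk ⟩
    2 ^ h * y ^ (y * h)                      ≤⟨ doubling-power y h 1≤y ⟩
    suc y ^ (y * h)                          ≡⟨ cong (suc y ^_) kk ⟨
    suc y ^ (k * k)                          ∎)
  where
  open ≤-Reasoning
  N = 2 ^ ℓ
  k = y * (4 * ℓ)
  h = y * (4 * ℓ * (4 * ℓ))
  kk : k * k ≡ y * h
  kk = a₁ y (4 * ℓ)
    where
    a₁ : ∀ a b → a * b * (a * b) ≡ a * (a * (b * b))
    a₁ = solve-∀
  exponent : 3 + (ℓ + (ℓ * k + ℓ * k)) < h
  exponent = begin-strict
    3 + (ℓ + (ℓ * k + ℓ * k))             ≤⟨ +-monoˡ-≤ (ℓ + (ℓ * k + ℓ * k)) (*-monoʳ-≤ 3 yll) ⟩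
    3 * (y * (ℓ * ℓ)) + (ℓ + (ℓ * k + ℓ * k)) ≤⟨ +-monoʳ-≤ (3 * (y * (ℓ * ℓ))) (+-monoˡ-≤ (ℓ * k + ℓ * k) l≤yll) ⟩
    3 * (y * (ℓ * ℓ)) + (y * (ℓ * ℓ) + (ℓ * k + ℓ * k)) ≡⟨ a₁ y ℓ ⟩
    12 * (y * (ℓ * ℓ))                    <⟨ *-monoˡ-< (y * (ℓ * ℓ)) ⦃ >-nonZero yll ⦄ {12} {16} (m≤m+n 13 3) ⟩
    16 * (y * (ℓ * ℓ))                    ≡⟨ a₂ y ℓ ⟩
    h                                     ∎
    where
    yll : 1 ≤ y * (ℓ * ℓ)
    yll = *-mono-≤ 1≤y (*-mono-≤ 1≤ℓ 1≤ℓ)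
    l≤yll : ℓ ≤ y * (ℓ * ℓ)
    l≤yll = begin
      ℓ ≡⟨ *-identityʳ ℓ ⟨
      ℓ * 1 ≤⟨ *-monoʳ-≤ ℓ 1≤ℓ ⟩
      ℓ * ℓ ≡⟨ *-identityˡ (ℓ * ℓ) ⟨
      1 * (ℓ * ℓ) ≤⟨ *-monoˡ-≤ (ℓ * ℓ) 1≤y ⟩
      y * (ℓ * ℓ) ∎
    a₁ : ∀ a b → 3 * (a * (b * b)) + (a * (b * b) + (b * (a * (4 * b)) + b * (a * (4 * b)))) ≡ 12 * (a * (b * b))
    a₁ = solve-∀
    a₂ : ∀ a b → 16 * (a * (b * b)) ≡ a * (4 * b * (4 * b))
    a₂ = solve-∀
  events : C * (N * (N ^ k * N ^ k)) < 2 ^ h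
  events = begin-strict
    C * (N * (N ^ k * N ^ k))       ≤⟨ *-monoˡ-≤ (N * (N ^ k * N ^ k)) C≤8 ⟩
    2 ^ 3 * (N * (N ^ k * N ^ k))   ≡⟨ cong (λ e → 2 ^ 3 * (N * (e * e))) (^-*-assoc 2 ℓ k) ⟩
    2 ^ 3 * (N * (2 ^ (ℓ * k) * 2 ^ (ℓ * k)))
      ≡⟨ cong (λ e → 2 ^ 3 * (N * e)) (^-distribˡ-+-* 2 (ℓ * k) (ℓ * k)) ⟨
    2 ^ 3 * (N * 2 ^ (ℓ * k + ℓ * k)) ≡⟨ cong (2 ^ 3 *_) (^-distribˡ-+-* 2 ℓ (ℓ * k + ℓ * k)) ⟨
    2 ^ 3 * 2 ^ (ℓ + (ℓ * k + ℓ * k)) ≡⟨ ^-distribˡ-+-* 2 3 (ℓ + (ℓ * k + ℓ * k)) ⟨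
    2 ^ (3 + (ℓ + (ℓ * k + ℓ * k))) <⟨ ^-monoʳ-< 2 (n<1+n 1) exponent ⟩
    2 ^ h                           ∎

-- Some class of the centre contains `k + k` leaves. Cut them into two disjoint sets of size `k`:
-- some pair across them carries the label prescribed for this class, and its triple with the centre
-- is red.
no-blueStar : ∀ {N C K k} (χ : Colouring N) (z : Fin N → Fin N → Fin K)
  (ζ : Fin N → Fin C → Fin N → Fin N → Fin K) (cls : Fin N → Fin N → Fin C) →
  (∀ v c f g → Disjoint f g → ∃₂ λ (i j : Fin k) → unordered z (f i) (g j) ≡ unordered (ζ v c) (f i) (g j)) →
  (∀ v x y → x ≢ v → y ≢ v → x ≢ y → cls v x ≡ cls v y →
     unordered z x y ≡ unordered (ζ v (cls v x)) x y → χ v x y ≡ true) →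
  1 ≤ C → ∀ n → C * (k + k) ≤ n → ¬ BlueStar χ n
no-blueStar {N} {C} {K} {k} χ z ζ cls rand red 1≤C n le (v , g , g-inj , av , blue) =
  finish (pigeonhole (k + k) 1≤C (cls v ∘ g) le)
  where
  finish : Fibre (cls v ∘ g) (k + k) → ⊥
  finish (c , ι , ι-inj , same) = clash (rand v c P Q disj)
    where
    P Q : Fin k → Fin N
    P i = g (ι (i Fin.↑ˡ k))
    Q i = g (ι (k Fin.↑ʳ i))
    disj : Disjoint P Q
    disj = (λ {i} {j} e → Finₚ.↑ˡ-injective k i j (ι-inj (g-inj e))) ,
           (λ {i} {j} e → Finₚ.↑ʳ-injective k i j (ι-inj (g-inj e))) ,
           (λ i j e → ↑ˡ≢↑ʳ i j (ι-inj (g-inj e)))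
    clash : (∃₂ λ (i j : Fin k) → unordered z (P i) (Q j) ≡ unordered (ζ v c) (P i) (Q j)) → ⊥
    clash (i , j , e) with () ← trans
        (sym (red v (P i) (Q j) (av _) (av _) (proj₂ (proj₂ disj) i j) (trans (same _) (sym (same _)))
          (trans e (cong (λ c → unordered (ζ v c) (P i) (Q j)) (sym (same _))))))
        (blue _ _ (λ p → ↑ˡ≢↑ʳ i j (ι-inj p)))

-- The exponential lower bound for s ≥ 5

⌊⌋-cong : ∀ {A B : Set} (a : Dec A) (b : Dec B) → (A → B) → (B → A) → ⌊ a ⌋ ≡ ⌊ b ⌋
⌊⌋-cong (yes _) (yes _) f g = refl
⌊⌋-cong (no _) (no _) f g = refl
⌊⌋-cong (yes a) (no b) f g = ⊥-elim (b (f a))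
⌊⌋-cong (no a) (yes b) f g = ⊥-elim (a (g b))

module _ {N : ℕ} (A : Fin N → Fin N → Fin N → Set) (A? : ∀ v x y → Dec (A v x y))
         (A-comm : ∀ {v x y} → A v x y → A v y x) where

  Red : Fin N → Fin N → Fin N → Set
  Red a b c = A a b c ⊎ A b a c ⊎ A c a b

  red? : ∀ a b c → Dec (Red a b c)
  red? a b c = A? a b c ⊎-dec (A? b a c ⊎-dec A? c a b)

  apexColouring : Colouring N
  apexColouring a b c = ⌊ red? a b c ⌋

  Red-swap₁ : ∀ {a b c} → Red a b c → Red b a c
  Red-swap₁ (inj₁ p) = inj₂ (inj₁ p)
  Red-swap₁ (inj₂ (inj₁ p)) = inj₁ p
  Red-swap₁ (inj₂ (inj₂ p)) = inj₂ (inj₂ (A-comm p))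

  Red-swap₂ : ∀ {a b c} → Red a b c → Red a c b
  Red-swap₂ (inj₁ p) = inj₁ (A-comm p)
  Red-swap₂ (inj₂ (inj₁ p)) = inj₂ (inj₂ p)
  Red-swap₂ (inj₂ (inj₂ p)) = inj₂ (inj₁ p)

  apexColouring-symmetric : Symmetric apexColouring
  apexColouring-symmetric a b c = ⌊⌋-cong (red? a b c) (red? b a c) Red-swap₁ Red-swap₁ ,
                                  ⌊⌋-cong (red? a b c) (red? a c b) Red-swap₂ Red-swap₂

side : ∀ {N} → Fin N → Fin N → Fin 2
side v x with x Fin.<? v
... | yes _ = zero
... | no _ = suc zero

same-side : ∀ {N} {v x y : Fin N} → x ≢ v → y ≢ v → side v x ≡ side v y →
  (side v x ≡ zero × x Fin.< v × y Fin.< v) ⊎ (side v x ≡ suc zero × v Fin.< x × v Fin.< y)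
same-side {v = v} {x} {y} x≢v y≢v e with x Fin.<? v | y Fin.<? v
... | yes p | yes q = inj₁ (refl , p , q)
... | no p | no q = inj₂ (refl , above p x≢v , above q y≢v)
  where
  above : ∀ {a b} → ¬ a Fin.< b → a ≢ b → b Fin.< a
  above {a} {b} ¬lt ne with Finₚ.<-cmp a b
  ... | tri< l _ _ = ⊥-elim (¬lt l)
  ... | tri≈ _ m _ = ⊥-elim (ne m)
  ... | tri> _ _ r = r

remQuot-combine-proj : ∀ {m n} (i : Fin m) (j : Fin n) →
  quotient {m} n (combine i j) ≡ i × remainder {m} n (combine i j) ≡ j
remQuot-combine-proj i j = cong proj₁ (Finₚ.remQuot-combine i j) , cong proj₂ (Finₚ.remQuot-combine i j)

-- Iterating this on the indices left over by `punchIn` sorts the vertices of a clique.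
argmin : ∀ {k N} (f : Fin (suc k) → Fin N) → Inj f → ∃ λ i → ∀ j → f i Fin.< f (Fin.punchIn i j)
argmin {zero} f inj = zero , λ ()
argmin {suc k} f inj with argmin (f ∘ suc) (Finₚ.suc-injective ∘ inj)
... | i , h with Finₚ.<-cmp (f zero) (f (suc i))
...   | tri≈ _ e _ with () ← inj e
...   | tri< lt _ _ = zero , below
  where
  below : ∀ j → f zero Fin.< f (suc j)
  below j with j Fin.≟ i
  ... | yes refl = lt
  ... | no ne = Finₚ.<-trans lt (subst (λ x → f (suc i) Fin.< f (suc x))
      (Finₚ.punchIn-punchOut (ne ∘ sym)) (h (Fin.punchOut (ne ∘ sym))))
...   | tri> _ _ gt = suc i , λ { zero → gt ; (suc j) → h j }

fin2 : ∀ {a b c : Fin 2} → a ≢ b → a ≢ c → b ≡ c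
fin2 {zero} {zero} p q = ⊥-elim (p refl)
fin2 {zero} {suc zero} {zero} p q = ⊥-elim (q refl)
fin2 {zero} {suc zero} {suc zero} p q = refl
fin2 {suc zero} {suc zero} p q = ⊥-elim (p refl)
fin2 {suc zero} {zero} {suc zero} p q = ⊥-elim (q refl)
fin2 {suc zero} {zero} {zero} p q = refl

-- A triple a < b < c is red iff z a b ≢ z b c.  In a red clique a < b < c < d < e the pair bc
-- would agree with bd (looking at a), bd with cd (looking at e), while bc ≢ cd.
module _ {N : ℕ} (z : Fin N → Fin N → Fin 2) where

  Mid : Fin N → Fin N → Fin N → Set
  Mid v x y = ((x Fin.< v × v Fin.< y) ⊎ (y Fin.< v × v Fin.< x)) × unordered z x v ≢ unordered z v y

  mid? : ∀ v x y → Dec (Mid v x y)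
  mid? v x y = (((x Fin.<? v) ×-dec (v Fin.<? y)) ⊎-dec ((y Fin.<? v) ×-dec (v Fin.<? x)))
    ×-dec ¬? (unordered z x v Fin.≟ unordered z v y)

  mid-comm : ∀ {v x y} → Mid v x y → Mid v y x
  mid-comm {v} {x} {y} (o , ne) = [ inj₂ , inj₁ ]′ o , λ e → ne
    (trans (unordered-comm z x v) (trans (sym e) (unordered-comm z y v)))

  mid-χ : Colouring N
  mid-χ = apexColouring Mid mid? mid-comm

  mid-increasing : ∀ {a b c} → a Fin.< b → b Fin.< c → mid-χ a b c ≡ true →
    unordered z a b ≢ unordered z b c
  mid-increasing {a} {b} {c} ab bc e with true-⌊⌋ (red? Mid mid? mid-comm a b c) e
  ... | inj₁ (inj₁ (ba , _) , _) = ⊥-elim (Finₚ.<-asym ab ba)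
  ... | inj₁ (inj₂ (ca , _) , _) = ⊥-elim (Finₚ.<-asym (Finₚ.<-trans ab bc) ca)
  ... | inj₂ (inj₁ (_ , ne)) = ne
  ... | inj₂ (inj₂ (inj₁ (_ , cb) , _)) = ⊥-elim (Finₚ.<-asym bc cb)
  ... | inj₂ (inj₂ (inj₂ (_ , ca) , _)) = ⊥-elim (Finₚ.<-asym (Finₚ.<-trans ab bc) ca)

  mid-no-redClique : ¬ RedClique mid-χ 5
  mid-no-redClique (f , inj , red) = contra
    where
    m₁ = argmin f inj
    i₁ = proj₁ m₁
    p₁ : Fin 4 → Fin 5
    p₁ = Fin.punchIn i₁
    p₁-inj : Inj (f ∘ p₁)
    p₁-inj e = Finₚ.punchIn-injective i₁ _ _ (inj e)
    m₂ = argmin (f ∘ p₁) p₁-inj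
    p₂ : Fin 3 → Fin 5
    p₂ = p₁ ∘ Fin.punchIn (proj₁ m₂)
    i₂ = p₁ (proj₁ m₂)
    p₂-inj : Inj (f ∘ p₂)
    p₂-inj e = Finₚ.punchIn-injective (proj₁ m₂) _ _ (p₁-inj e)
    m₃ = argmin (f ∘ p₂) p₂-inj
    p₃ : Fin 2 → Fin 5
    p₃ = p₂ ∘ Fin.punchIn (proj₁ m₃)
    i₃ = p₂ (proj₁ m₃)
    p₃-inj : Inj (f ∘ p₃)
    p₃-inj e = Finₚ.punchIn-injective (proj₁ m₃) _ _ (p₂-inj e)
    m₄ = argmin (f ∘ p₃) p₃-inj
    p₄ : Fin 1 → Fin 5
    p₄ = p₃ ∘ Fin.punchIn (proj₁ m₄)
    i₄ = p₃ (proj₁ m₄)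
    i₅ = p₄ zero
    l₁₂ : f i₁ Fin.< f i₂
    l₁₂ = proj₂ m₁ _
    l₂₃ : f i₂ Fin.< f i₃
    l₂₃ = proj₂ m₂ _
    l₃₄ : f i₃ Fin.< f i₄
    l₃₄ = proj₂ m₃ _
    l₄₅ : f i₄ Fin.< f i₅
    l₄₅ = proj₂ m₄ _
    l₂₄ = Finₚ.<-trans l₂₃ l₃₄
    apart : ∀ {i j} → f i Fin.< f j → i ≢ j
    apart l refl = Finₚ.<-irrefl refl l
    rule : ∀ {i j k} → f i Fin.< f j → f j Fin.< f k → unordered z (f i) (f j) ≢ unordered z (f j) (f k)
    rule a b = mid-increasing a b (red _ _ _ (apart a) (apart b) (apart (Finₚ.<-trans a b)))
    contra : ⊥
    contra = rule l₂₃ l₃₄ (trans (fin2 (rule l₁₂ l₂₃) (rule l₁₂ l₂₄))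
                                 (fin2 (rule l₂₄ l₄₅ ∘ sym) (rule l₃₄ l₄₅ ∘ sym)))

  mid-cls : Fin N → Fin N → Fin 4
  mid-cls v x = combine (side v x) (unordered z v x)

flip : Fin 2 → Fin 2
flip zero = suc zero
flip (suc zero) = zero

flip≢ : ∀ i → flip i ≢ i
flip≢ zero ()
flip≢ (suc zero) ()

mid-ζ : ∀ {N} → Fin N → Fin 4 → Fin N → Fin N → Fin 2
mid-ζ _ c _ _ = flip (remainder {2} 2 c)

-- As `v` lies on the same side of `x` and `y`, one of these two is the middle vertex. The pairs at
-- `v` share a label and the pair `x`, `y` has the flipped one, so the labels at the middle vertex
-- differ.
mid-red : ∀ {N} (z : Fin N → Fin N → Fin 2) v x y → x ≢ v → y ≢ v → x ≢ y → mid-cls z v x ≡ mid-cls z v y →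
  unordered z x y ≡ unordered (mid-ζ v (mid-cls z v x)) x y → mid-χ z v x y ≡ true
mid-red {N} z v x y x≢v y≢v x≢y same e = ⌊⌋-true (red? (Mid z) (mid? z) (mid-comm z) v x y)
    (go (same-side x≢v y≢v (Finₚ.combine-injectiveˡ _ _ _ _ same)) (Finₚ.<-cmp x y))
  where
  zy : unordered z v x ≡ unordered z v y
  zy = Finₚ.combine-injectiveʳ (side v x) _ (side v y) _ same
  value : unordered z x y ≡ flip (unordered z v x)
  value = trans e (trans (unordered-symmetric (mid-ζ {N} v (mid-cls z v x)) (λ _ _ → refl) x y)
            (cong flip (proj₂ (remQuot-combine-proj (side v x) (unordered z v x)))))
  xy≢ : unordered z v x ≢ unordered z x y
  xy≢ p = flip≢ _ (sym (trans p value))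
  yx≢ : unordered z v y ≢ unordered z y x
  yx≢ p = xy≢ (trans zy (trans p (unordered-comm z y x)))
  go : (side v x ≡ zero × x Fin.< v × y Fin.< v) ⊎ (side v x ≡ suc zero × v Fin.< x × v Fin.< y) →
       _ → Red (Mid z) (mid? z) (mid-comm z) v x y
  go _ (tri≈ _ p _) = ⊥-elim (x≢y p)
  go (inj₁ (_ , xv , yv)) (tri< xy _ _) = inj₂ (inj₂ (inj₂ (xy , yv) , yx≢))
  go (inj₁ (_ , xv , yv)) (tri> _ _ yx) = inj₂ (inj₁ (inj₂ (yx , xv) , xy≢))
  go (inj₂ (_ , vx , vy)) (tri< xy _ _) = inj₂ (inj₁ (inj₁ (vx , xy) , xy≢))
  go (inj₂ (_ , vx , vy)) (tri> _ _ yx) = inj₂ (inj₂ (inj₁ (vy , yx) , yx≢))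

redClique-mono : ∀ {N s s′} {χ : Colouring N} → s ≤ s′ → RedClique χ s′ → RedClique χ s
redClique-mono le (f , inj , red) = (λ i → f (Fin.inject≤ i le)) ,
  (λ e → Finₚ.inject≤-injective le le _ _ (inj e)) ,
  λ i j k a b c → red _ _ _ (a ∘ Finₚ.inject≤-injective le le _ _) (b ∘ Finₚ.inject≤-injective le le _ _)
                            (c ∘ Finₚ.inject≤-injective le le _ _)

-- With two labels the random sets have size `4 * t`; there are four classes, a side together with a
-- label, and two sets per class, hence `32 * t`.
¬arrows-exponential : ∀ t s n → 1 ≤ t → 5 ≤ s → 32 * t ≤ n → ¬ Arrows (2 ^ t) s n
¬arrows-exponential t s n 1≤t 5≤s le A = refute (random-colouring t 2 4 1≤t ≤-refl (m≤m+n 4 4) mid-ζ)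
  where
  bound : 4 * (1 * (4 * t) + 1 * (4 * t)) ≤ n
  bound = ≤-trans (≤-reflexive (arith t)) le
    where
    arith : ∀ t → 4 * (1 * (4 * t) + 1 * (4 * t)) ≡ 32 * t
    arith = solve-∀
  refute : (Σ (Fin (2 ^ t) → Fin (2 ^ t) → Fin 2) λ z → ∀ v c f g → Disjoint f g →
    ∃₂ λ (i j : Fin (1 * (4 * t))) → unordered z (f i) (g j) ≡ unordered (mid-ζ v c) (f i) (g j)) → ⊥
  refute (z , rand) = [ mid-no-redClique z ∘ redClique-mono {χ = mid-χ z} 5≤s ,
      no-blueStar (mid-χ z) z mid-ζ (mid-cls z) rand (mid-red z) (s≤s z≤n) n bound ]′
    (A (mid-χ z) (apexColouring-symmetric (Mid z) (mid? z) (mid-comm z)))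

-- The quasipolynomial lower bound for s = 4

funToFin-cong : ∀ {m n} {f g : Fin m → Fin n} → f ≗ g → funToFin f ≡ funToFin g
funToFin-cong {zero} e = refl
funToFin-cong {suc m} e = cong₂ combine (e zero) (funToFin-cong (e ∘ suc))

finToFun-injective : ∀ m n {i j : Fin (n ^ m)} → finToFun {n} {m} i ≗ finToFun {n} {m} j → i ≡ j
finToFun-injective m n {i} {j} e = trans (sym (Finₚ.funToFin-finToFin {m} {n} i))
  (trans (funToFin-cong e) (Finₚ.funToFin-finToFin {m} {n} j))

funToFin-injective : ∀ {m n} {f g : Fin m → Fin n} → funToFin f ≡ funToFin g → f ≗ g
funToFin-injective {f = f} {g} e i = trans (sym (Finₚ.finToFun-funToFin f i))
  (trans (cong (λ x → finToFun x i) e) (Finₚ.finToFun-funToFin g i))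

agreement : ∀ {ℓ Q} → (Fin ℓ → Fin Q) → (Fin ℓ → Fin Q) → ℕ
agreement f g = count (λ j → f j ≡ᵇᶠ g j)

agreement-comm : ∀ {ℓ Q} (f g : Fin ℓ → Fin Q) → agreement f g ≡ agreement g f
agreement-comm f g = sum-cong-≗ +-*-semiring (λ j → cong 𝟙 (⌊⌋-cong (f j Fin.≟ g j) (g j Fin.≟ f j) sym sym))

Code : ℕ → ℕ → ℕ → ℕ → Set
Code m ℓ Q D = Σ (Fin m → Fin ℓ → Fin Q) λ f → ∀ u v → u ≢ v → agreement (f u) (f v) ≤ D

-- The greedy step of the Gilbert-Varshamov bound: for each old word and each of the `2 ^ ℓ` masks
-- with more than `D` positions, a random word agrees on the whole mask with probability at most
-- Q^(-(D+1)).
fresh-codeword : ∀ {m ℓ} Q D → 1 ≤ Q → m * 2 ^ ℓ < Q ^ suc D → (f : Fin m → Fin ℓ → Fin Q) →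
  Σ (Fin ℓ → Fin Q) λ x → ∀ u → agreement x (f u) ≤ D
fresh-codeword {m} {ℓ} Q D 1≤Q lt f = finish (avoid-restrictions ℓ 1 (suc D) S valid mask small many 1≤Q 1≤Q
    (subst (_< Q ^ suc D) (sym (trans (cong (m * 2 ^ ℓ *_) (^-zeroˡ (suc D))) (*-identityʳ _))) lt))
  where
  T = m * 2 ^ ℓ
  word : Fin T → Fin m
  word t = quotient {m} (2 ^ ℓ) t
  mask : Fin T → Fin ℓ → Bool
  mask t j = finToFun {2} {ℓ} (remainder {m} (2 ^ ℓ) t) j ≡ᵇᶠ suc zero
  S : Fin T → Fin ℓ → Fin Q → Bool
  S t j κ = not (mask t j) ∨ (f (word t) j ≡ᵇᶠ κ)
  valid : Fin T → Bool
  valid t = ⌊ suc D ≤? count (mask t) ⌋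
  small : ∀ t j → mask t j ≡ true → count (S t j) ≤ 1
  small t j e = ≤-reflexive (trans
    (sum-cong-≗ +-*-semiring (λ κ → cong (λ b → 𝟙 (not b ∨ (f (word t) j ≡ᵇᶠ κ))) e))
    (count-≡ (f (word t) j)))
  many : ∀ t → valid t ≡ true → suc D ≤ count (mask t)
  many t = true-⌊⌋ (suc D ≤? count (mask t))
  finish : (Σ (Fin ℓ → Fin Q) λ x → ∀ t → valid t ≡ true → ∃ λ j → S t j (x j) ≡ false) →
    Σ (Fin ℓ → Fin Q) λ x → ∀ u → agreement x (f u) ≤ D
  finish (x , ok) = x , λ u → ≮⇒≥ (clash u)
    where
    clash : ∀ u → ¬ (suc D ≤ agreement x (f u))
    clash u le = contra (ok t (⌊⌋-true (suc D ≤? count (mask t)) (≤-trans le (≤-reflexive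
        (sum-cong-≗ +-*-semiring (λ j → cong 𝟙 (sym (mask≡ j))))))))
      where
      bit : Bool → Fin 2
      bit true = suc zero
      bit false = zero
      bit-inv : ∀ b → (bit b ≡ᵇᶠ suc zero) ≡ b
      bit-inv true = refl
      bit-inv false = refl
      mask₀ : Fin ℓ → Fin 2
      mask₀ j = bit (x j ≡ᵇᶠ f u j)
      t : Fin T
      t = combine u (funToFin mask₀)
      dec : remQuot (2 ^ ℓ) t ≡ (u , funToFin mask₀)
      dec = Finₚ.remQuot-combine u (funToFin mask₀)
      mask≡ : ∀ j → mask t j ≡ (x j ≡ᵇᶠ f u j)
      mask≡ j = trans (cong (λ r → finToFun {2} {ℓ} (proj₂ r) j ≡ᵇᶠ suc zero) dec)
        (trans (cong (_≡ᵇᶠ suc zero) (Finₚ.finToFun-funToFin mask₀ j)) (bit-inv _))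
      S≡ : ∀ j → S t j (x j) ≡ not (x j ≡ᵇᶠ f u j) ∨ (f u j ≡ᵇᶠ x j)
      S≡ j = cong₂ (λ b w → not b ∨ (f w j ≡ᵇᶠ x j)) (mask≡ j) (cong proj₁ dec)
      contra : (∃ λ j → S t j (x j) ≡ false) → ⊥
      contra (j , e) with x j Fin.≟ f u j | trans (sym (S≡ j)) e
      ... | yes p | q with () ← trans (sym (trans (cong (_≡ᵇᶠ x j) (sym p)) (≡ᵇᶠ-refl (x j)))) q

code-exists : ∀ m ℓ Q D → 1 ≤ Q → m * 2 ^ ℓ < Q ^ suc D → Code m ℓ Q D
code-exists zero ℓ Q D 1≤Q lt = (λ ()) , λ ()
code-exists (suc m) ℓ Q D 1≤Q lt = add (code-exists m ℓ Q D 1≤Q lt′)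
  where
  lt′ : m * 2 ^ ℓ < Q ^ suc D
  lt′ = ≤-<-trans (m≤n+m (m * 2 ^ ℓ) (2 ^ ℓ)) lt
  add : Code m ℓ Q D → Code (suc m) ℓ Q D
  add (f , far) = extend (fresh-codeword Q D 1≤Q lt′ f)
    where
    extend : (Σ (Fin ℓ → Fin Q) λ x → ∀ u → agreement x (f u) ≤ D) → Code (suc m) ℓ Q D
    extend (x , new) = x ◂ f , far′
      where
      far′ : ∀ u v → u ≢ v → agreement ((x ◂ f) u) ((x ◂ f) v) ≤ D
      far′ zero zero ne = ⊥-elim (ne refl)
      far′ zero (suc v) ne = new v
      far′ (suc u) zero ne = ≤-trans (≤-reflexive (agreement-comm (f u) x)) (new u)
      far′ (suc u) (suc v) ne = far u v (ne ∘ cong suc)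

next : Fin 3 → Fin 3
next zero = suc zero
next (suc zero) = suc (suc zero)
next (suc (suc zero)) = zero

next≢ : ∀ i → next i ≢ i
next≢ zero ()
next≢ (suc zero) ()
next≢ (suc (suc zero)) ()

-- An apex joined to the base in colour a, the base having the next colour.
Tri : Fin 3 → Fin 3 → Fin 3 → Set
Tri a b c = a ≡ b × c ≡ next a

Triangle : Fin 3 → Fin 3 → Fin 3 → Set
Triangle ab ac bc = Tri ab ac bc ⊎ Tri ab bc ac ⊎ Tri ac bc ab

-- The colour pattern of a 4-set split into two pairs with colours p and q; the other
-- arguments are the colours across.
Split : Fin 3 → Fin 3 → Fin 3 → Fin 3 → Fin 3 → Fin 3 → Set
Split p q c₁ c₂ c₃ c₄ = c₁ ≡ c₂ × c₁ ≡ c₃ × c₁ ≡ c₄ × p ≡ next c₁ × q ≡ next c₁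

-- Decided by running through all 3^6 colourings of the six pairs.
K₄-split : ∀ c₁₂ c₁₃ c₁₄ c₂₃ c₂₄ c₃₄ →
  Triangle c₁₂ c₁₃ c₂₃ → Triangle c₁₂ c₁₄ c₂₄ → Triangle c₁₃ c₁₄ c₃₄ → Triangle c₂₃ c₂₄ c₃₄ →
  Split c₁₂ c₃₄ c₁₃ c₁₄ c₂₃ c₂₄ ⊎ Split c₁₃ c₂₄ c₁₂ c₁₄ c₂₃ c₃₄ ⊎ Split c₁₄ c₂₃ c₁₂ c₁₃ c₂₄ c₃₄
K₄-split = from-yes (Finₚ.all? λ c₁₂ → Finₚ.all? λ c₁₃ → Finₚ.all? λ c₁₄ → Finₚ.all? λ c₂₃ →
    Finₚ.all? λ c₂₄ → Finₚ.all? λ c₃₄ →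
    triangle? c₁₂ c₁₃ c₂₃ →-dec (triangle? c₁₂ c₁₄ c₂₄ →-dec (triangle? c₁₃ c₁₄ c₃₄ →-dec
    (triangle? c₂₃ c₂₄ c₃₄ →-dec
    (split? c₁₂ c₃₄ c₁₃ c₁₄ c₂₃ c₂₄ ⊎-dec (split? c₁₃ c₂₄ c₁₂ c₁₄ c₂₃ c₃₄ ⊎-dec split? c₁₄ c₂₃ c₁₂ c₁₃ c₂₄ c₃₄))))))
  where
  tri? : ∀ a b c → Dec (Tri a b c)
  tri? a b c = (a Fin.≟ b) ×-dec (c Fin.≟ next a)
  triangle? : ∀ a b c → Dec (Triangle a b c)
  triangle? a b c = tri? a b c ⊎-dec (tri? a c b ⊎-dec tri? b c a)
  split? : ∀ p q c₁ c₂ c₃ c₄ → Dec (Split p q c₁ c₂ c₃ c₄)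
  split? p q c₁ c₂ c₃ c₄ = (c₁ Fin.≟ c₂) ×-dec ((c₁ Fin.≟ c₃) ×-dec ((c₁ Fin.≟ c₄) ×-dec
    ((p Fin.≟ next c₁) ×-dec (q Fin.≟ next c₁))))

-- Vertices are bit strings of length ℓ, and each also carries a codeword of length ℓ over an
-- alphabet of size 2 ^ D.  A pair {x , y} below its apex v is red only if its label is the letter of
-- v at a position where x and y differ; a pair {x , y} above v only if its label encodes the bits
-- of v at all positions where the codewords of x and y agree.  For x , y < v , w with all four
-- triples red these two requirements are contradictory.
module _ (ℓ D : ℕ) (code : Code (2 ^ ℓ) ℓ (2 ^ D) D) where

  private
    N Q : ℕ
    N = 2 ^ ℓ
    Q = 2 ^ D

  -- Position `zero` is the junk position returned by `cover` and `separator`; letters and bits are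
  -- constant there.
  letter : Fin N → Fin (suc ℓ) → Fin Q
  letter v zero = funToFin {D} {2} (λ _ → zero)
  letter v (suc j) = proj₁ code v j

  bit : Fin N → Fin (suc ℓ) → Fin 2
  bit v zero = zero
  bit v (suc j) = finToFun {2} {ℓ} v j

  Separates : Fin N → Fin N → Fin (suc ℓ) → Set
  Separates x y p = x ≢ y → ∃ λ j → p ≡ suc j × bit x p ≢ bit y p

  separator : ∀ x y → Σ (Fin (suc ℓ)) (Separates x y)
  separator x y with Finₚ.any? (λ j → ¬? (bit x (suc j) Fin.≟ bit y (suc j)))
  ... | yes (j , ne) = suc j , λ _ → j , refl , ne
  ... | no none = zero , λ x≢y → ⊥-elim (x≢y (finToFun-injective ℓ 2 same))
    where
    same : ∀ j → bit x (suc j) ≡ bit y (suc j)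
    same j with bit x (suc j) Fin.≟ bit y (suc j)
    ... | yes e = e
    ... | no ne = ⊥-elim (none (j , ne))

  sep : Fin N → Fin N → Fin (suc ℓ)
  sep = unordered (λ x y → proj₁ (separator x y))

  sep-separates : ∀ x y → Separates x y (sep x y)
  sep-separates = unordered-elim Separates _
    (λ s y≢x → let j , e , ne = s (y≢x ∘ sym) in j , e , ne ∘ sym) (λ x y → proj₂ (separator x y))

  Covers : Fin N → Fin N → (Fin D → Fin (suc ℓ)) → Set
  Covers x y h = x ≢ y → ∀ j → letter x (suc j) ≡ letter y (suc j) → ∃ λ i → h i ≡ suc j

  covering : ∀ x y → Σ (Fin D → Fin (suc ℓ)) (Covers x y)
  covering x y with x Fin.≟ y
  ... | yes x≡y = (λ _ → zero) , λ x≢y → ⊥-elim (x≢y x≡y)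
  ... | no x≢y with cover (λ j → proj₁ code x j ≡ᵇᶠ proj₁ code y j) (proj₂ code x y x≢y)
  ...   | h , ok = h , λ _ j e → ok j (⌊⌋-true (proj₁ code x j Fin.≟ proj₁ code y j) e)

  agr : Fin N → Fin N → Fin D → Fin (suc ℓ)
  agr = unordered (λ x y → proj₁ (covering x y))

  agr-covers : ∀ x y → Covers x y (agr x y)
  agr-covers = unordered-elim Covers _
    (λ c y≢x j e → c (y≢x ∘ sym) j (sym e)) (λ x y → proj₂ (covering x y))

  -- The first argument follows `side`: `zero` when the pair lies below `v`, `suc zero` when it lies
  -- above. In the latter case `D` bits just fit into an alphabet of size `2 ^ D`.
  label : Fin 2 → Fin N → Fin N → Fin N → Fin Q
  label zero v x y = letter v (sep x y)
  label (suc zero) v x y = funToFin {D} {2} (λ i → bit v (agr x y i))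

  label-comm : ∀ s v x y → label s v x y ≡ label s v y x
  label-comm zero v x y = cong (letter v) (unordered-comm _ x y)
  label-comm (suc zero) v x y =
    cong (λ (h : Fin D → Fin (suc ℓ)) → funToFin {D} {2} (λ i → bit v (h i)))
      (unordered-comm (λ x y → proj₁ (covering x y)) x y)

  -- By the first equation the codewords of `b` and `b′` agree at the position separating `a` from
  -- `a′`. So this position is among those covered by `agr b b′`, where by the second equation `a`
  -- and `a′` have equal bits.
  label-clash : ∀ {a a′ b b′} → a ≢ a′ → b ≢ b′ → label zero b a a′ ≡ label zero b′ a a′ →
    label (suc zero) a b b′ ≡ label (suc zero) a′ b b′ → ⊥
  label-clash {a} {a′} {b} {b′} a≢ b≢ e e′ with sep a a′ | sep-separates a a′ a≢
  ... | _ | j , refl , ne with agr-covers b b′ b≢ j e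
  ...   | i , q = ne (subst (λ p → bit a p ≡ bit a′ p) q (funToFin-injective {D} {2} e′ i))

  ζ : Fin N → Fin 6 → Fin N → Fin N → Fin (3 * Q)
  ζ v c x y = combine (next (remainder {2} 3 c)) (label (quotient {2} 3 c) v x y)

  module _ (z : Fin N → Fin N → Fin (3 * Q)) where

    private
      u : Fin N → Fin N → Fin (3 * Q)
      u = unordered z

    φ : Fin N → Fin N → Fin 3
    φ x y = quotient Q (u x y)

    φ-comm : ∀ x y → φ x y ≡ φ y x
    φ-comm x y = cong (quotient Q) (unordered-comm z x y)

    Apex′ : Fin 2 → Fin N → Fin N → Fin N → Set
    Apex′ s v x y = φ v x ≡ φ v y × u x y ≡ combine (next (φ v x)) (label s v x y)

    Apex : Fin N → Fin N → Fin N → Set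
    Apex v x y = ((x Fin.< v × y Fin.< v) × Apex′ zero v x y) ⊎ ((v Fin.< x × v Fin.< y) × Apex′ (suc zero) v x y)

    apex? : ∀ v x y → Dec (Apex v x y)
    apex? v x y = (((x Fin.<? v) ×-dec (y Fin.<? v)) ×-dec apex′? zero) ⊎-dec
                  (((v Fin.<? x) ×-dec (v Fin.<? y)) ×-dec apex′? (suc zero))
      where
      apex′? : ∀ s → Dec (Apex′ s v x y)
      apex′? s = (φ v x Fin.≟ φ v y) ×-dec (u x y Fin.≟ combine (next (φ v x)) (label s v x y))

    apex-comm : ∀ {v x y} → Apex v x y → Apex v y x
    apex-comm {v} {x} {y} = λ { (inj₁ ((p , q) , r)) → inj₁ ((q , p) , swap zero r)
                              ; (inj₂ ((p , q) , r)) → inj₂ ((q , p) , swap (suc zero) r) }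
      where
      swap : ∀ s → Apex′ s v x y → Apex′ s v y x
      swap s (e , q) = sym e , trans (unordered-comm z y x) (trans q
        (cong₂ (λ c l → combine (next c) l) e (label-comm s v x y)))

    apex-triangle : ∀ {v x y} → Apex v x y → Tri (φ v x) (φ v y) (φ x y)
    apex-triangle {v} {x} {y} = λ { (inj₁ (_ , r)) → tri zero r ; (inj₂ (_ , r)) → tri (suc zero) r }
      where
      tri : ∀ s → Apex′ s v x y → Tri (φ v x) (φ v y) (φ x y)
      tri s (e , q) = e , trans (cong (quotient Q) q) (proj₁ (remQuot-combine-proj (next (φ v x)) (label s v x y)))

    R : Fin N → Fin N → Fin N → Set
    R = Red Apex apex? apex-comm

    swap-l : ∀ {a b c} → R a b c → R b a c
    swap-l = Red-swap₁ Apex apex? apex-comm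

    swap-r : ∀ {a b c} → R a b c → R a c b
    swap-r = Red-swap₂ Apex apex? apex-comm

    red-triangle : ∀ {a b c} → R a b c → Triangle (φ a b) (φ a c) (φ b c)
    red-triangle (inj₁ p) = inj₁ (apex-triangle p)
    red-triangle {a} {b} {c} (inj₂ (inj₁ p)) =
      inj₂ (inj₁ (subst (λ w → Tri w (φ b c) (φ a c)) (φ-comm b a) (apex-triangle p)))
    red-triangle {a} {b} {c} (inj₂ (inj₂ p)) =
      inj₂ (inj₂ (subst₂ (λ w w′ → Tri w w′ (φ a b)) (φ-comm c a) (φ-comm c b) (apex-triangle p)))

    -- An apex at `x` or `y` would give the pair `x`, `y` the colour `c` of the pairs at `v`, but
    -- its colour is `next c`.
    apex-of : ∀ {x y v c} → R x y v → φ x y ≡ next c → c ≡ φ x v → c ≡ φ y v → Apex v x y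
    apex-of {c = c} (inj₁ p) e a b = ⊥-elim (next≢ c (trans (sym e) (trans (proj₁ (apex-triangle p)) (sym a))))
    apex-of {x} {y} {c = c} (inj₂ (inj₁ p)) e a b =
      ⊥-elim (next≢ c (trans (sym e) (trans (φ-comm x y) (trans (proj₁ (apex-triangle p)) (sym b)))))
    apex-of (inj₂ (inj₂ p)) e a b = p

    same-label : ∀ s v w x y → Apex′ s v x y → Apex′ s w x y → label s v x y ≡ label s w x y
    same-label s v w x y (_ , e) (_ , e′) = Finₚ.combine-injectiveʳ (next (φ v x)) (label s v x y)
      (next (φ w x)) (label s w x y) (trans (sym e) e′)

    -- Every apex lies wholly above or wholly below its base. The four orders are compatible only if
    -- one pair lies entirely below the other, and then the labels clash.
    no-split : ∀ p q r t → p ≢ q → r ≢ t → Apex r p q → Apex t p q → Apex p r t → Apex q r t → ⊥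
    no-split p q r t pq rt (inj₁ (_ , a)) (inj₁ (_ , b)) (inj₂ (_ , c)) (inj₂ (_ , d)) =
      label-clash pq rt (same-label zero r t p q a b) (same-label (suc zero) p q r t c d)
    no-split p q r t pq rt (inj₂ (_ , a)) (inj₂ (_ , b)) (inj₁ (_ , c)) (inj₁ (_ , d)) =
      label-clash rt pq (same-label zero p q r t c d) (same-label (suc zero) r t p q a b)
    no-split p q r t pq rt (inj₁ ((l , _) , _)) _ (inj₁ ((m , _) , _)) _ = Finₚ.<-asym l m
    no-split p q r t pq rt (inj₁ ((_ , l) , _)) _ _ (inj₁ ((m , _) , _)) = Finₚ.<-asym l m
    no-split p q r t pq rt _ (inj₂ ((l , _) , _)) (inj₂ ((_ , m) , _)) _ = Finₚ.<-asym l m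
    no-split p q r t pq rt (inj₂ ((l , _) , _)) _ (inj₂ ((m , _) , _)) _ = Finₚ.<-asym l m
    no-split p q r t pq rt (inj₂ ((_ , l) , _)) _ _ (inj₂ ((m , _) , _)) = Finₚ.<-asym l m
    no-split p q r t pq rt _ (inj₁ ((l , _) , _)) (inj₁ ((_ , m) , _)) _ = Finₚ.<-asym l m

    split-impossible : ∀ {p q r t} → p ≢ q → r ≢ t → R p q r → R p q t → R p r t → R q r t →
      Split (φ p q) (φ r t) (φ p r) (φ p t) (φ q r) (φ q t) → ⊥
    split-impossible {p} {q} {r} {t} p≢q r≢t pqr pqt prt qrt (e₁ , e₂ , e₃ , e , e′) =
      no-split p q r t p≢q r≢t (apex-of pqr e refl e₂) (apex-of pqt e e₁ e₃)
        (apex-of (swap-r (swap-l prt)) e′ (φ-comm p r) (trans e₁ (φ-comm p t)))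
        (apex-of (swap-r (swap-l qrt)) e′ (trans e₂ (φ-comm q r)) (trans e₃ (φ-comm q t)))

    χ : Colouring N
    χ = apexColouring Apex apex? apex-comm

    no-redClique : ¬ RedClique χ 4
    no-redClique (f , inj , red) = refute (K₄-split (φ a b) (φ a c) (φ a d) (φ b c) (φ b d) (φ c d)
        (red-triangle abc) (red-triangle abd) (red-triangle acd) (red-triangle bcd))
      where
      i₁ i₂ i₃ i₄ : Fin 4
      i₁ = zero
      i₂ = suc zero
      i₃ = suc (suc zero)
      i₄ = suc (suc (suc zero))
      a = f i₁
      b = f i₂
      c = f i₃
      d = f i₄
      isRed : ∀ i j k → i ≢ j → j ≢ k → i ≢ k → R (f i) (f j) (f k)
      isRed i j k p q r = true-⌊⌋ (red? Apex apex? apex-comm (f i) (f j) (f k)) (red i j k p q r)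
      abc : R a b c
      abc = isRed i₁ i₂ i₃ (λ ()) (λ ()) (λ ())
      abd : R a b d
      abd = isRed i₁ i₂ i₄ (λ ()) (λ ()) (λ ())
      acd : R a c d
      acd = isRed i₁ i₃ i₄ (λ ()) (λ ()) (λ ())
      bcd : R b c d
      bcd = isRed i₂ i₃ i₄ (λ ()) (λ ()) (λ ())
      ne : ∀ {i j} → i ≢ j → f i ≢ f j
      ne p e = p (inj e)
      refute : Split (φ a b) (φ c d) (φ a c) (φ a d) (φ b c) (φ b d) ⊎
               Split (φ a c) (φ b d) (φ a b) (φ a d) (φ b c) (φ c d) ⊎
               Split (φ a d) (φ b c) (φ a b) (φ a c) (φ b d) (φ c d) → ⊥
      refute (inj₁ s) = split-impossible (ne λ ()) (ne λ ()) abc abd acd bcd s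
      refute (inj₂ (inj₁ s)) = split-impossible (ne λ ()) (ne λ ()) (swap-r abc) acd abd (swap-l bcd)
        (subst (λ w → Split (φ a c) (φ b d) (φ a b) (φ a d) w (φ c d)) (φ-comm b c) s)
      refute (inj₂ (inj₂ s)) = split-impossible (ne λ ()) (ne λ ()) (swap-r abd) (swap-r acd) abc (swap-l (swap-r bcd))
        (subst₂ (λ w w′ → Split (φ a d) (φ b c) (φ a b) (φ a c) w w′) (φ-comm b d) (φ-comm c d) s)

    cls : Fin N → Fin N → Fin 6
    cls v x = combine (side v x) (φ v x)

    link-red : ∀ v x y → x ≢ v → y ≢ v → x ≢ y → cls v x ≡ cls v y →
      u x y ≡ unordered (ζ v (cls v x)) x y → χ v x y ≡ true
    link-red v x y x≢v y≢v _ same e = ⌊⌋-true (red? Apex apex? apex-comm v x y)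
        (inj₁ (go (same-side x≢v y≢v (Finₚ.combine-injectiveˡ _ _ _ _ same))))
      where
      value : u x y ≡ combine (next (φ v x)) (label (side v x) v x y)
      value = trans e (trans
        (unordered-symmetric (ζ v (cls v x)) (λ a b → cong (combine (next (remainder {2} 3 (cls v x))))
          (label-comm (quotient {2} 3 (cls v x)) v a b)) x y)
        (cong (λ r → combine (next (proj₂ r)) (label (proj₁ r) v x y)) (Finₚ.remQuot-combine (side v x) (φ v x))))
      apex′ : ∀ s → side v x ≡ s → Apex′ s v x y
      apex′ s e = Finₚ.combine-injectiveʳ (side v x) _ (side v y) _ same ,
        trans value (cong (λ s → combine (next (φ v x)) (label s v x y)) e)
      go : (side v x ≡ zero × x Fin.< v × y Fin.< v) ⊎ (side v x ≡ suc zero × v Fin.< x × v Fin.< y) → Apex v x y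
      go (inj₁ (s , o)) = inj₁ (o , apex′ zero s)
      go (inj₂ (s , o)) = inj₂ (o , apex′ (suc zero) s)

-- The code exists because `ℓ + ℓ = 2 * (t * t)` is below `D * suc D = 4 * (t * t) + 2 * t`. An
-- alphabet of size `2 ^ (2 * t)` keeps six classes of `k + k` leaves within 144 t² 2^(2t), at most
-- `2 ^ (12 * t)`.
¬arrows-4-quasipolynomial : ∀ t n → 1 ≤ t → 2 ^ (12 * t) ≤ n → ¬ Arrows (2 ^ (t * t)) 4 n
¬arrows-4-quasipolynomial t n 1≤t le A = refute-code (code-exists (2 ^ ℓ) ℓ (2 ^ D) D (m^n>0 2 D) words)
  where
  open ≤-Reasoning
  ℓ D K k : ℕ
  ℓ = t * t
  D = 2 * t
  K = 3 * 2 ^ D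
  k = pred K * (4 * ℓ)
  words : 2 ^ ℓ * 2 ^ ℓ < (2 ^ D) ^ suc D
  words = begin-strict
    2 ^ ℓ * 2 ^ ℓ     ≡⟨ ^-distribˡ-+-* 2 ℓ ℓ ⟨
    2 ^ (ℓ + ℓ)       <⟨ ^-monoʳ-< 2 (n<1+n 1) exponent ⟩
    2 ^ (D * suc D)   ≡⟨ ^-*-assoc 2 D (suc D) ⟨
    (2 ^ D) ^ suc D   ∎
    where
    a₁ : ∀ t → (t * t + t * t) + (2 * (t * t) + 2 * t) ≡ 2 * t * suc (2 * t)
    a₁ = solve-∀
    exponent : ℓ + ℓ < D * suc D
    exponent = begin-strict
      ℓ + ℓ                          ≡⟨ +-identityʳ (ℓ + ℓ) ⟨
      ℓ + ℓ + 0                      <⟨ +-monoʳ-< (ℓ + ℓ) (≤-trans 1≤t (≤-trans (m≤m+n t _) (m≤n+m (2 * t) (2 * (t * t))))) ⟩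
      ℓ + ℓ + (2 * (t * t) + 2 * t)  ≡⟨ a₁ t ⟩
      D * suc D                      ∎
  leaves-bound : 6 * (k + k) ≤ n
  leaves-bound = begin
    6 * (k + k)                     ≤⟨ *-monoʳ-≤ 6 (+-mono-≤ k≤ k≤) ⟩
    6 * (K * (4 * ℓ) + K * (4 * ℓ)) ≡⟨ a₁ (2 ^ D) t ⟩
    144 * (2 ^ D * (t * t))         ≤⟨ *-mono-≤ {144} {2 ^ 8} (m≤m+n 144 112)
          (*-monoʳ-≤ (2 ^ D) (*-mono-≤ (<⇒≤ (n<2^n t)) (<⇒≤ (n<2^n t)))) ⟩
    2 ^ 8 * (2 ^ D * (2 ^ t * 2 ^ t)) ≡⟨ cong (λ e → 2 ^ 8 * (2 ^ D * e)) (^-distribˡ-+-* 2 t t) ⟨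
    2 ^ 8 * (2 ^ D * 2 ^ (t + t))   ≡⟨ cong (2 ^ 8 *_) (^-distribˡ-+-* 2 D (t + t)) ⟨
    2 ^ 8 * 2 ^ (D + (t + t))       ≡⟨ ^-distribˡ-+-* 2 8 (D + (t + t)) ⟨
    2 ^ (8 + (D + (t + t)))         ≤⟨ ^-monoʳ-≤ 2 exponent ⟩
    2 ^ (12 * t)                    ≤⟨ le ⟩
    n                               ∎
    where
    k≤ : k ≤ K * (4 * ℓ)
    k≤ = *-monoˡ-≤ (4 * ℓ) (pred[n]≤n {K})
    a₁ : ∀ q t → 6 * (3 * q * (4 * (t * t)) + 3 * q * (4 * (t * t))) ≡ 144 * (q * (t * t))
    a₁ = solve-∀
    exponent : 8 + (D + (t + t)) ≤ 12 * t
    exponent = begin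
      8 * 1 + (2 * t + (t + t)) ≤⟨ +-monoˡ-≤ (2 * t + (t + t)) (*-monoʳ-≤ 8 1≤t) ⟩
      8 * t + (2 * t + (t + t)) ≡⟨ a₂ t ⟩
      12 * t                    ∎
      where
      a₂ : ∀ t → 8 * t + (2 * t + (t + t)) ≡ 12 * t
      a₂ = solve-∀
  2≤K : 2 ≤ K
  2≤K = ≤-trans (m≤m+n 2 1) (*-monoʳ-≤ 3 (m^n>0 2 D))
  refute-code : Code (2 ^ ℓ) ℓ (2 ^ D) D → ⊥
  refute-code code = refute (random-colouring ℓ K 6 (*-mono-≤ 1≤t 1≤t) 2≤K (m≤m+n 6 2) (ζ ℓ D code))
    where
    refute : (Σ (Fin (2 ^ ℓ) → Fin (2 ^ ℓ) → Fin K) λ z → ∀ v c f g → Disjoint f g →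
      ∃₂ λ (i j : Fin k) → unordered z (f i) (g j) ≡ unordered (ζ ℓ D code v c) (f i) (g j)) → ⊥
    refute (z , rand) = [ no-redClique ℓ D code z ,
        no-blueStar (χ ℓ D code z) z (ζ ℓ D code) (cls ℓ D code z) rand (link-red ℓ D code z)
          (s≤s z≤n) n leaves-bound ]′
      (A (χ ℓ D code z) (apexColouring-symmetric (Apex ℓ D code z) (apex? ℓ D code z) (apex-comm ℓ D code z)))

-- From special parameters to bounds for all n

div-bound : ∀ x d .⦃ _ : NonZero d ⦄ → x < d * suc (x / d)
div-bound x d = begin-strict
  x                     ≡⟨ m≡m%n+[m/n]*n x d ⟩
  x % d + x / d * d     <⟨ +-monoˡ-< (x / d * d) (m%n<n x d) ⟩
  d + x / d * d         ≡⟨ cong (d +_) (*-comm (x / d) d) ⟩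
  d + d * (x / d)       ≡⟨ *-suc d (x / d) ⟨
  d * suc (x / d)       ∎
  where open ≤-Reasoning

div-mult≤ : ∀ x d .⦃ _ : NonZero d ⦄ → d * (x / d) ≤ x
div-mult≤ x d = begin
  d * (x / d)           ≡⟨ *-comm d (x / d) ⟩
  x / d * d             ≤⟨ m≤n+m (x / d * d) (x % d) ⟩
  x % d + x / d * d     ≡⟨ m≡m%n+[m/n]*n x d ⟨
  x                     ∎
  where open ≤-Reasoning

suc≤2* : ∀ {t} → 1 ≤ t → suc t ≤ 2 * t
suc≤2* {suc t} _ = s≤s (≤-trans (m≤n+m (suc t) t) (≤-reflexive (cong (t +_) (sym (+-identityʳ (suc t))))))

power-bound : ∀ e q x r → 2 ^ e ≤ r → x ≤ e * q → 2 ^ x ≤ r ^ q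
power-bound e q x r le x≤ = begin
  2 ^ x        ≤⟨ ^-monoʳ-≤ 2 x≤ ⟩
  2 ^ (e * q)  ≡⟨ ^-*-assoc 2 e q ⟨
  (2 ^ e) ^ q  ≤⟨ ^-monoˡ-≤ q le ⟩
  r ^ q        ∎
  where open ≤-Reasoning

-- Take `t` to be `L / 12`. If `t` is positive then `L ≤ 24 * t`, and 576 is the square of 24;
-- otherwise `L ≤ 12` and `2 ≤ r` is enough.
lower-4 : ∀ n r → 2 ≤ n → IsRamseyNumber 4 n r → 2 ^ (⌊log₂ n ⌋ * ⌊log₂ n ⌋) ≤ r ^ 576
lower-4 n r 2≤n isR = cases (L / 12) refl
  where
  open ≤-Reasoning
  L = ⌊log₂ n ⌋
  2≤r : 2 ≤ r
  2≤r = <-ramsey isR (nonempty n 2≤n)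
    where
    nonempty : ∀ n → 2 ≤ n → ¬ Arrows 1 4 n
    nonempty (suc n) _ = ¬arrows-1 2 n
  cases : ∀ t → L / 12 ≡ t → 2 ^ (L * L) ≤ r ^ 576
  cases zero e = power-bound 1 576 (L * L) r 2≤r (≤-trans (*-mono-≤ L≤12 L≤12) (m≤m+n 144 432))
    where
    L≤12 : L ≤ 12
    L≤12 = <⇒≤ (subst (λ q → L < 12 * suc q) e (div-bound L 12))
  cases t@(suc _) e = power-bound (t * t) 576 (L * L) r
      (<⇒≤ (<-ramsey isR (¬arrows-4-quasipolynomial t n (s≤s z≤n) big)))
      (≤-trans (*-mono-≤ L≤24t L≤24t) (≤-reflexive (arith 24 t)))
    where
    arith : ∀ c t → c * t * (c * t) ≡ t * t * (c * c)
    arith = solve-∀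
    arith₂ : ∀ t → 12 * (2 * t) ≡ 24 * t
    arith₂ = solve-∀
    L≤24t : L ≤ 24 * t
    L≤24t = begin
      L              ≤⟨ <⇒≤ (subst (λ q → L < 12 * suc q) e (div-bound L 12)) ⟩
      12 * suc t     ≤⟨ *-monoʳ-≤ 12 (suc≤2* (s≤s z≤n)) ⟩
      12 * (2 * t)   ≡⟨ arith₂ t ⟩
      24 * t         ∎
    big : 2 ^ (12 * t) ≤ n
    big = ≤-trans (^-monoʳ-≤ 2 (subst (λ q → 12 * q ≤ L) e (div-mult≤ L 12)))
                  (2^⌊log₂n⌋≤n n (≤-trans (s≤s z≤n) 2≤n))

lower-s : ∀ s n r → 5 ≤ s → 2 ≤ n → IsRamseyNumber s n r → 2 ^ n ≤ r ^ 64
lower-s s n r 5≤s 2≤n isR = cases (n / 32) refl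
  where
  open ≤-Reasoning
  2≤r : 2 ≤ r
  2≤r = <-ramsey isR (nonempty s n 5≤s 2≤n)
    where
    nonempty : ∀ s n → 5 ≤ s → 2 ≤ n → ¬ Arrows 1 s n
    nonempty (suc (suc s)) (suc n) _ _ = ¬arrows-1 s n
    nonempty (suc zero) _ (s≤s ()) _
  cases : ∀ t → n / 32 ≡ t → 2 ^ n ≤ r ^ 64
  cases zero e = power-bound 1 64 n r 2≤r
    (≤-trans (<⇒≤ (subst (λ q → n < 32 * suc q) e (div-bound n 32))) (m≤m+n 32 32))
  cases t@(suc _) e = power-bound t 64 n r
      (<⇒≤ (<-ramsey isR (¬arrows-exponential t s n (s≤s z≤n) 5≤s (subst (λ q → 32 * q ≤ n) e (div-mult≤ n 32)))))
      n≤64t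
    where
    arith : ∀ t → 32 * (2 * t) ≡ t * 64
    arith = solve-∀
    n≤64t : n ≤ t * 64
    n≤64t = begin
      n              ≤⟨ <⇒≤ (subst (λ q → n < 32 * suc q) e (div-bound n 32)) ⟩
      32 * suc t     ≤⟨ *-monoʳ-≤ 32 (suc≤2* (s≤s z≤n)) ⟩
      32 * (2 * t)   ≡⟨ arith t ⟩
      t * 64         ∎

theorem1p2 : (Σ ℕ λ q → Σ ℕ λ p → 1 ≤ q × 1 ≤ p ×
    ((n : ℕ) → 2 ≤ n → Σ ℕ λ r → IsRamseyNumber 4 n r ×
    (2 ^ (⌊log₂ n ⌋ * ⌊log₂ n ⌋) ≤ r ^ q) ×
    ((m : ℕ) → n * n ≤ m * m * m → r ≤ 2 ^ (p * m * ⌈log₂ n ⌉))))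
    ×
    ((s : ℕ) → 5 ≤ s →
    Σ ℕ λ q → Σ ℕ λ p → 1 ≤ q × 1 ≤ p ×
    ((n : ℕ) → 2 ≤ n → Σ ℕ λ r → IsRamseyNumber s n r ×
    (2 ^ n ≤ r ^ q) × (r ≤ 2 ^ (p * n))))
theorem1p2 = (576 , 40 , s≤s z≤n , s≤s z≤n , case-4) ,
  λ s 5≤s → 64 , 2 * s * s , s≤s z≤n , *-mono-≤ (*-mono-≤ {1} {2} (s≤s z≤n) (1≤ 5≤s)) (1≤ 5≤s) , case-s s 5≤s
  where
  1≤ : ∀ {m k} → suc m ≤ k → 1 ≤ k
  1≤ = ≤-trans (s≤s z≤n)
  case-4 : (n : ℕ) → 2 ≤ n → Σ ℕ λ r → IsRamseyNumber 4 n r ×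
    (2 ^ (⌊log₂ n ⌋ * ⌊log₂ n ⌋) ≤ r ^ 576) ×
    ((m : ℕ) → n * n ≤ m * m * m → r ≤ 2 ^ (40 * m * ⌈log₂ n ⌉))
  case-4 n 2≤n = let r , isR = ramsey-exists _ 4 n (arrows-2^ 4 n (s≤s z≤n) (1≤ 2≤n)) in
    r , isR , lower-4 n r 2≤n isR , λ m h → ramsey-≤ isR (arrows-4-subexponential n m 2≤n h)
  case-s : (s : ℕ) → 5 ≤ s → (n : ℕ) → 2 ≤ n → Σ ℕ λ r → IsRamseyNumber s n r ×
    (2 ^ n ≤ r ^ 64) × (r ≤ 2 ^ (2 * s * s * n))
  case-s s 5≤s n 2≤n = let A = arrows-2^ s n (1≤ 5≤s) (1≤ 2≤n)
                           r , isR = ramsey-exists _ s n A in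
    r , isR , lower-s s n r 5≤s 2≤n isR , ramsey-≤ isR A
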